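{- If $G$ is a graph with maximum degree at most $3$, girth at least $7$, and $\mathrm{mad}(G)<\frac{18}{7}$, then $\chi_l(G^2)\le 6$.
   Context: All graphs are finite and simple. $\mathrm{mad}(G)$, the maximum average degree of $G$, is the maximum of $2|E(H)|/|V(H)|$ over all induced subgraphs $H$ of $G$. The square $G^2$ of $G$ has vertex set $V(G)$, with two vertices adjacent if their distance in $G$ is at most $2$. $\chi_l$ denotes the list chromatic number. -}

module Defs where

open import Data.Nat using (ℕ; zero; suc; _+_; _*_; _≤_; _<_)
open import Data.Nat.Properties using (_<?_)
open import Data.Bool using (Bool; true; false; _∧_; _∨_; not; if_then_else_)
open import Data.Fin using (Fin; zero; suc; toℕ; inject₁; fromℕ; _≟_)
open import Data.Fin.Subset using (Subset; _∈_; Nonempty; ∣_∣)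
open import Data.Vec using (lookup)
open import Data.List using (List; map; length)
open import Data.Nat.ListAction using (sum)
open import Data.Bool.ListAction using (any)
open import Data.List using () renaming (allFin to allFinL)
open import Data.List.Relation.Unary.Unique.Propositional using (Unique)
import Data.List.Membership.Propositional as LM
open import Function.Definitions using (Injective)
open import Relation.Binary.PropositionalEquality using (_≡_)
open import Relation.Nullary using (¬_)
open import Relation.Nullary.Decidable using (⌊_⌋)
open import Data.Product using (Σ; _×_)

record Graph (n : ℕ) : Set where
  field
    adj   : Fin n → Fin n → Bool
    sym   : ∀ u v → adj u v ≡ adj v u
    irrefl : ∀ v → adj v v ≡ false
open Graph public

b2n : Bool → ℕ
b2n true  = 1
b2n false = 0

degree : ∀ {n} → Graph n → Fin n → ℕ
degree {n} G v = sum (map (λ u → b2n (adj G v u)) (allFinL n))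

MaxDegreeAtMost : ∀ {n} → Graph n → ℕ → Set
MaxDegreeAtMost G d = ∀ v → degree G v ≤ d

-- A cycle of length (suc m) in G: an injective cyclic sequence of vertices
-- c 0, c 1, ..., c m with consecutive vertices (and c m, c 0) adjacent.
-- For suc m ≥ 3 this is exactly a cycle (subgraph) of length suc m.
IsCycle : ∀ {n} → Graph n → (m : ℕ) → (Fin (suc m) → Fin n) → Set
IsCycle G m c =
  Injective _≡_ _≡_ c ×
  (∀ (i : Fin m) → adj G (c (inject₁ i)) (c (suc i)) ≡ true) ×
  (adj G (c (fromℕ m)) (c zero) ≡ true)

GirthAtLeast : ∀ {n} → Graph n → ℕ → Set
GirthAtLeast {n} G g = ∀ (m : ℕ) → 3 ≤ suc m → suc m < g →
  ∀ (c : Fin (suc m) → Fin n) → ¬ IsCycle G m c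

inS : ∀ {n} → Subset n → Fin n → Bool
inS S v = lookup S v

inducedEdges : ∀ {n} → Graph n → Subset n → ℕ
inducedEdges {n} G S =
  sum (map (λ u → sum (map (λ v →
    b2n (⌊ toℕ u <? toℕ v ⌋ ∧ inS S u ∧ inS S v ∧ adj G u v))
    (allFinL n))) (allFinL n))

-- mad(G) < p / q  (q > 0): every nonempty induced subgraph H satisfies
-- 2|E(H)| / |V(H)| < p / q, i.e. q * 2|E(H)| < p * |V(H)|.
MadLessThan : ∀ {n} → Graph n → ℕ → ℕ → Set
MadLessThan G p q = ∀ S → Nonempty S → q * (2 * inducedEdges G S) < p * ∣ S ∣

sqAdj : ∀ {n} → Graph n → Fin n → Fin n → Bool
sqAdj {n} G u v = not ⌊ u ≟ v ⌋ ∧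
  (adj G u v ∨ any (λ w → adj G u w ∧ adj G w v) (allFinL n))

Choosable : ∀ {n} → (Fin n → Fin n → Bool) → ℕ → Set
Choosable {n} A k =
  ∀ (L : Fin n → List ℕ) →
  (∀ v → Unique (L v)) → (∀ v → length (L v) ≡ k) →
  Σ (Fin n → ℕ) λ c →
    (∀ v → c v LM.∈ L v) ×
    (∀ u v → A u v ≡ true → ¬ (c u ≡ c v))

{-# OPTIONS --safe #-}
module Submission where

open import Defs renaming (sym to symmetric)
open import Data.Bool using (Bool; true; false; _∧_; _∨_; not; if_then_else_)
open import Data.Bool.ListAction using (any)
open import Data.Empty using (⊥-elim)
open import Data.Fin using (Fin; zero; suc; inject₁; fromℕ; toℕ)
open import Data.Fin.Patterns
open import Data.Fin.Subset using (Subset; _⊂_; ∣_∣) renaming (⊤ to full)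
open import Data.Fin.Subset.Induction using (⊂-wellFounded; Acc; acc)
open import Data.Fin.Subset.Properties using (nonempty?; ∈⊤)
open import Data.List
  using (List; []; _∷_; _++_; map; filter; foldr; take; length; concatMap; allFin)
open import Data.List.Membership.Propositional using (_∈_; _∉_; find; lose)
open import Data.List.Membership.Propositional.Properties
  using (∈-filter⁺; ∈-filter⁻; ∈-allFin; ∈-map⁺; ∈-map⁻; ∈-++⁺ˡ; ∈-++⁺ʳ; ∈-++⁻; ∈-concatMap⁺;
         ∈-concatMap⁻; ∈-lookup; ∈-∃++)
open import Data.List.Properties
  using (filter-all; filter-accept; filter-reject; filter-notAll; length-++; length-map;
         length-take; map-cong; map-tabulate)
open import Data.List.Relation.Binary.Permutation.Propositional
  using (_↭_; ↭-refl; ↭-sym; ↭-trans; ↭-prep; ↭-swap; ↭⇒↭ₛ)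
open import Data.List.Relation.Binary.Permutation.Propositional.Properties
  using (∈-resp-↭; shift; ↭-length) renaming (map⁺ to ↭-map⁺)
open import Data.List.Relation.Unary.All using (All; []; _∷_)
open import Data.List.Relation.Unary.AllPairs using ([]; _∷_)
open import Data.List.Relation.Unary.Any using (Any; here; there)
open import Data.List.Relation.Unary.Unique.Propositional using (Unique)
open import Data.Maybe using (Maybe; just; nothing)
open import Data.Nat using (ℕ; zero; suc; _+_; _*_; _∸_; _≤_; _<_; z≤n; s≤s)
open import Data.Nat.ListAction using (sum)
open import Data.Nat.ListAction.Properties using (sum-↭)
open import Data.Product using (Σ-syntax; ∃; ∃-syntax; _×_; _,_; proj₁; proj₂)
open import Data.Sum using (_⊎_; inj₁; inj₂)
open import Data.Unit using (⊤; tt)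
open import Data.Vec using ([]; _∷_; lookup; tabulate)
open import Function using (_∘_; id; flip)
open import Relation.Binary.PropositionalEquality
  using (_≡_; _≢_; refl; sym; trans; cong; cong₂; subst; subst₂; setoid; module ≡-Reasoning)
open import Relation.Nullary using (¬_; Dec; yes; no; contradiction)
open import Relation.Nullary.Decidable
  using (⌊_⌋; ¬?; _×-dec_; _⊎-dec_; _→-dec_; decidable-stable; map′; toWitness)
import Data.Bool.Properties as Bool
import Data.Fin as Fin
import Data.Fin.Properties as Fin
import Data.List as List
import Data.List.Membership.DecPropositional as DecMem
import Data.List.Relation.Binary.Permutation.Setoid.Properties as Permutation
import Data.List.Relation.Unary.All as All
import Data.List.Relation.Unary.Any as Any
import Data.List.Relation.Unary.Any.Properties as Any
import Data.List.Relation.Unary.Unique.Propositional.Properties as Unique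
import Data.Nat as ℕ
import Data.Nat.Properties as ℕ
import Data.Product.Properties as Product
import Data.Vec.Properties as Vec

-- In a minimal counterexample, an induced tree all of whose vertices have at most one outer
-- neighbour cannot occur if its square can be coloured greedily from the lists that survive a
-- colouring of the rest; girth 7 guarantees that the square of the graph induces on the tree
-- only the square of the tree.  "Greedily" allows a vertex to take a colour missing from the
-- list of a neighbour, which exists when its own list is longer.  Calling a 3-vertex of class i
-- if it has i neighbours of degree 2, this excludes: degree at most 1; adjacent 2-vertices; a
-- 2-vertex between classes 3 and at least 2; adjacent vertices of class 2; a vertex of class 1
-- with two neighbours of class 2; and a vertex of class 1 with neighbours of classes 1 and 2
-- that has distance 2 from class 3.  Discharging 7 deg - 18 then contradicts mad < 18/7.

-- A 2-vertex starts with charge -4, a 3-vertex with 3. Two gifts of 2 settle a 2-vertex, but class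
-- 3 can afford only 1 for each, so the other neighbour of its 2-neighbour pays 3. Class 2 spends 2
-- + 2, and class 1 may have to spend 3 + 1; each is then short by 1, which its remaining neighbour
-- supplies. The excluded configurations are the cases in which this bill could not be met. The
-- limit of one outer neighbour has this reason: a colouring of the rest respects only the square of
-- the subgraph induced on the rest, so two outer neighbours of one deleted vertex might share a
-- colour. Plain greedy colouring fails on the four larger trees, because each of their vertices has
-- at least as many tree vertices within distance 2 as colours. A spared vertex is always a pendant
-- 2-vertex with three colours and three such tree vertices; one of these three takes a colour
-- missing from its list, and the pendant vertex is coloured last in its star.

-- Deleting colours from lists

del : ℕ → List ℕ → List ℕ
del x = filter (λ y → ¬? (y ℕ.≟ x))

delAll : List ℕ → List ℕ → List ℕ
delAll xs ys = foldr del ys xs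

length-del : ∀ x {ys} → Unique ys → length ys ≤ suc (length (del x ys))
length-del x {[]} _ = z≤n
length-del x {y ∷ ys} (y∉ys ∷ u) with y ℕ.≟ x
... | no y≢x   rewrite filter-accept (λ z → ¬? (z ℕ.≟ x)) {xs = ys} y≢x = s≤s (length-del x u)
... | yes refl rewrite filter-reject (λ z → ¬? (z ℕ.≟ y)) {xs = ys} (λ ¬eq → ¬eq refl)
                     | filter-all (λ z → ¬? (z ℕ.≟ y)) (All.map (_∘ sym) y∉ys) = ℕ.≤-refl

delAll-unique : ∀ xs {ys} → Unique ys → Unique (delAll xs ys)
delAll-unique []       u = u
delAll-unique (x ∷ xs) u = Unique.filter⁺ _ (delAll-unique xs u)

length-delAll : ∀ xs {ys} → Unique ys → length ys ≤ length xs + length (delAll xs ys)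
length-delAll []       u = ℕ.≤-refl
length-delAll (x ∷ xs) {ys} u = begin
  length ys                                        ≤⟨ length-delAll xs u ⟩
  length xs + length (delAll xs ys)                ≤⟨ ℕ.+-monoʳ-≤ (length xs) (length-del x (delAll-unique xs u)) ⟩
  length xs + suc (length (delAll (x ∷ xs) ys))    ≡⟨ ℕ.+-suc (length xs) _ ⟩
  suc (length xs + length (delAll (x ∷ xs) ys))    ∎
  where open ℕ.≤-Reasoning

∈-delAll⁻ : ∀ xs {ys z} → z ∈ delAll xs ys → z ∈ ys × z ∉ xs
∈-delAll⁻ []       z∈ = z∈ , λ ()
∈-delAll⁻ (x ∷ xs) z∈ with z∈′ , z≢x ← ∈-filter⁻ _ {xs = delAll xs _} z∈
                      with z∈ys , z∉xs ← ∈-delAll⁻ xs z∈′ =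
  z∈ys , λ { (here z≡x) → z≢x z≡x ; (there z∈xs) → z∉xs z∈xs }

∈-take⁻ : ∀ m (xs : List ℕ) {z} → z ∈ take m xs → z ∈ xs
∈-take⁻ (suc m) (x ∷ xs) (here eq)  = here eq
∈-take⁻ (suc m) (x ∷ xs) (there z∈) = there (∈-take⁻ m xs z∈)

pickOutside : ∀ {xs} ys → Unique xs → length ys < length xs → Σ[ x ∈ ℕ ] x ∈ xs × x ∉ ys
pickOutside {xs} ys u lt with delAll ys xs in eq
... | x ∷ _ = x , ∈-delAll⁻ ys (subst (x ∈_) (sym eq) (here refl))
... | []    = contradiction
  (ℕ.≤-trans (length-delAll ys u) (ℕ.≤-reflexive (trans (cong ((length ys +_) ∘ length) eq) (ℕ.+-identityʳ _))))
  (ℕ.<⇒≱ lt)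

-- Greedy list colouring with spared lists

-- A step (i , just j) gives i a colour outside the current list of j, so that j loses nothing.
Plan : ℕ → Set
Plan k = List (Fin k × Maybe (Fin k))

planned : ∀ {k} → Plan k → List (Fin k)
planned = map proj₁

spares : ∀ {k} → Maybe (Fin k) → Fin k → Bool
spares nothing  j = false
spares (just s) j = ⌊ s Fin.≟ j ⌋

sparedSize : ∀ {k} → Maybe (Fin k) → (Fin k → ℕ) → ℕ
sparedSize nothing  g = 0
sparedSize (just s) g = g s

sizesAfter : ∀ {k} → (Fin k → Fin k → Bool) → Fin k → Maybe (Fin k) → (Fin k → ℕ) → Fin k → ℕ
sizesAfter E i t g j = if E i j ∧ not (spares t j) then g j ∸ 1 else g j

-- Depends on list sizes alone, so one evaluation settles a plan for all lists. With `nothing` the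
-- inequality says that the list of i is nonempty.
Feasible : ∀ {k} → (Fin k → Fin k → Bool) → Plan k → (Fin k → ℕ) → Set
Feasible E []            g = ⊤
Feasible E ((i , t) ∷ p) g = i ∉ planned p × sparedSize t g < g i × Feasible E p (sizesAfter E i t g)

_∈ᶠ?_ : ∀ {k} (i : Fin k) xs → Dec (i ∈ xs)
_∈ᶠ?_ = DecMem._∈?_ Fin._≟_

feasible? : ∀ {k} E (p : Plan k) g → Dec (Feasible E p g)
feasible? E []            g = yes tt
feasible? E ((i , t) ∷ p) g =
  ¬? (i ∈ᶠ? planned p) ×-dec (sparedSize t g ℕ.<? g i) ×-dec feasible? E p (sizesAfter E i t g)

-- Both directions of `E` are asked for because either vertex may come first in the plan, and only
-- the earlier one strikes its colour from the other list.
greedy : ∀ {k} E (p : Plan k) g → Feasible E p g →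
  (L : Fin k → List ℕ) → (∀ i → Unique (L i)) → (∀ i → length (L i) ≡ g i) →
  Σ[ c ∈ (Fin k → ℕ) ]
    (∀ i → i ∈ planned p → c i ∈ L i) ×
    (∀ i j → i ∈ planned p → j ∈ planned p → i ≢ j → E i j ≡ true → E j i ≡ true → c i ≢ c j)
greedy E [] g _ L _ _ = (λ _ → 0) , (λ _ ()) , (λ _ _ ())
greedy {k} E ((i , t) ∷ p) g (i∉p , lt , feasible) L unique len = c , c∈L , proper
  where
  spared : Maybe (Fin k) → List ℕ
  spared nothing  = []
  spared (just s) = L s

  length-spared : ∀ t → length (spared t) ≡ sparedSize t g
  length-spared nothing  = refl
  length-spared (just s) = len s

  choice : Σ[ x ∈ ℕ ] x ∈ L i × x ∉ spared t
  choice = pickOutside (spared t) (unique i)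
    (subst₂ _<_ (sym (length-spared t)) (sym (len i)) lt)

  x : ℕ
  x = proj₁ choice

  -- Cutting to the predicted size keeps the lengths exact. Lower bounds would not do: sparing
  -- compares two lists, and the spared one must not be too long.
  L′ : Fin k → List ℕ
  L′ j = if E i j ∧ not (spares t j) then take (g j ∸ 1) (del x (L j)) else L j

  unique′ : ∀ j → Unique (L′ j)
  unique′ j with E i j ∧ not (spares t j)
  ... | true  = Unique.take⁺ (g j ∸ 1) (Unique.filter⁺ _ (unique j))
  ... | false = unique j

  len′ : ∀ j → length (L′ j) ≡ sizesAfter E i t g j
  len′ j with E i j ∧ not (spares t j)
  ... | false = len j
  ... | true  = trans (length-take (g j ∸ 1) _) (ℕ.m≤n⇒m⊓n≡m
    (subst (λ m → m ∸ 1 ≤ length (del x (L j))) (len j) (ℕ.∸-monoˡ-≤ 1 (length-del x (unique j)))))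

  L′⊆L : ∀ j {y} → y ∈ L′ j → y ∈ L j
  L′⊆L j y∈ with E i j ∧ not (spares t j)
  ... | false = y∈
  ... | true  = proj₁ (∈-filter⁻ _ (∈-take⁻ (g j ∸ 1) _ y∈))

  ∉spared : ∀ t → x ∉ spared t → ∀ j → spares t j ≡ true → x ∉ L j
  ∉spared (just s) x∉ j eq with s Fin.≟ j
  ... | yes refl = x∉

  L′-avoids : ∀ j {y} → E i j ≡ true → y ∈ L′ j → y ≢ x
  L′-avoids j e y∈ with E i j | spares t j in eq
  L′-avoids j refl y∈ | true | true  = λ { refl → ∉spared t (proj₂ (proj₂ choice)) j eq y∈ }
  L′-avoids j refl y∈ | true | false = proj₂ (∈-filter⁻ _ {xs = L j} (∈-take⁻ (g j ∸ 1) _ y∈))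

  ih = greedy E p (sizesAfter E i t g) feasible L′ unique′ len′

  c : Fin k → ℕ
  c j = if ⌊ j Fin.≟ i ⌋ then x else proj₁ ih j

  c∈L : ∀ j → j ∈ i ∷ planned p → c j ∈ L j
  c∈L j j∈ with j Fin.≟ i
  c∈L j j∈         | yes refl = proj₁ (proj₂ choice)
  c∈L j (here eq)  | no j≢i   = contradiction eq j≢i
  c∈L j (there j∈) | no j≢i   = L′⊆L j (proj₁ (proj₂ ih) j j∈)

  later : ∀ {j} → j ≢ i → j ∈ i ∷ planned p → j ∈ planned p
  later j≢i (here eq)  = contradiction eq j≢i
  later j≢i (there j∈) = j∈

  proper : ∀ a b → a ∈ i ∷ planned p → b ∈ i ∷ planned p → a ≢ b →
    E a b ≡ true → E b a ≡ true → c a ≢ c b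
  proper a b a∈ b∈ a≢b eab eba with a Fin.≟ i | b Fin.≟ i
  ... | yes refl | yes refl = contradiction refl a≢b
  ... | yes refl | no b≢i   = L′-avoids b eab (proj₁ (proj₂ ih) b (later b≢i b∈)) ∘ sym
  ... | no a≢i   | yes refl = L′-avoids a eba (proj₁ (proj₂ ih) a (later a≢i a∈))
  ... | no a≢i   | no b≢i   = proj₂ (proj₂ ih) a b (later a≢i a∈) (later b≢i b∈) a≢b eab eba

-- Reducible trees

-- A configuration is an induced tree T all of whose vertices have at most one neighbour outside T;
-- o i bounds the number of outer neighbours of i, and exempt lists pairs whose
-- distance is not controlled by T and the girth alone.
record Shape : Set where
  field
    size-1  : ℕ
  size : ℕ
  size = suc size-1
  field
    T      : Fin size → List (Fin size)
    o      : Fin size → ℕ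
    exempt : List (Fin size × Fin size)
    plan   : Plan size

  close : Fin size → Fin size → Bool
  close i j = ⌊ j ∈ᶠ? T i ⌋ ∨ any (λ m → ⌊ j ∈ᶠ? T m ⌋) (T i)

  -- An outer neighbour of i blocks itself and its two other neighbours.
  listSize : Fin size → ℕ
  listSize i = 6 ∸ (3 * o i + sum (map o (T i)))

  -- Tree counterpart of `NB` below: the final vertices of the non-backtracking walks that continue
  -- the edge p x by d steps.
  ends : ℕ → Fin size → Fin size → List (Fin size)
  ends zero    p x = x ∷ []
  ends (suc d) p x = concatMap (ends d x) (filter (λ y → ¬? (y Fin.≟ p)) (T x))

  -- These are the tree distances 3 and 4: a second connection of length at most 2 would close a
  -- walk of at most 6 edges. At distance 5 the closed walk may have 7 edges, which girth 7 permits;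
  -- such pairs go to `exempt`.
  far : Fin size → List (Fin size)
  far i = concatMap (λ x → ends 2 i x ++ ends 3 i x) (T i)

  Separated : Fin size → Fin size → Set
  Separated i j = i ≡ j ⊎ close i j ≡ true ⊎ j ∈ far i ⊎ (i , j) ∈ exempt ⊎ (j , i) ∈ exempt

  Sound : Set
  Sound = (∀ i → All (λ j → i ∈ T j) (T i)) ×
          (∀ i → o i ≤ 1) ×
          (∀ i j → Separated i j) ×
          (∀ i → i ∈ planned plan) ×
          Feasible close plan listSize

  sound? : Dec Sound
  sound? = Fin.all? (λ i → All.all? (λ j → i ∈ᶠ? T j) (T i)) ×-dec
           Fin.all? (λ i → o i ℕ.≤? 1) ×-dec
           Fin.all? (λ i → Fin.all? (λ j →
             (i Fin.≟ j) ⊎-dec (close i j Bool.≟ true) ⊎-dec (j ∈ᶠ? far i) ⊎-dec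
             ((i , j) ∈ᵖ? exempt) ⊎-dec ((j , i) ∈ᵖ? exempt))) ×-dec
           Fin.all? (λ i → i ∈ᶠ? planned plan) ×-dec
           feasible? close plan listSize
    where _∈ᵖ?_ = DecMem._∈?_ (Product.≡-dec Fin._≟_ Fin._≟_)

isolated : Shape
isolated = record
  { size-1 = 0 ; T = λ _ → [] ; o = λ _ → 1 ; exempt = [] ; plan = (0F , nothing) ∷ [] }

twoTwo : Shape
twoTwo = record
  { size-1 = 1
  ; T      = lookup ((1F ∷ []) ∷ (0F ∷ []) ∷ [])
  ; o      = λ _ → 1
  ; exempt = []
  ; plan   = (0F , nothing) ∷ (1F , nothing) ∷ []
  }

-- 0 has class 3 with 2-neighbours 1, 2, 3; the other neighbour 4 of 1 has a second 2-neighbour 5.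
class3NearClass2 : Shape
class3NearClass2 = record
  { size-1 = 5
  ; T      = lookup ((1F ∷ 2F ∷ 3F ∷ []) ∷ (0F ∷ 4F ∷ []) ∷ (0F ∷ []) ∷ (0F ∷ [])
                     ∷ (1F ∷ 5F ∷ []) ∷ (4F ∷ []) ∷ [])
  ; o      = lookup (0 ∷ 0 ∷ 1 ∷ 1 ∷ 1 ∷ 1 ∷ [])
  ; exempt = []
  ; plan   = (0F , just 2F) ∷ (4F , nothing) ∷ (5F , nothing) ∷ (1F , nothing)
             ∷ (3F , nothing) ∷ (2F , nothing) ∷ []
  }

-- Adjacent 0 and 1 of class 2, with 2-neighbours 2, 3 and 4, 5.
class2Class2 : Shape
class2Class2 = record
  { size-1 = 5
  ; T      = lookup ((2F ∷ 3F ∷ 1F ∷ []) ∷ (4F ∷ 5F ∷ 0F ∷ []) ∷ (0F ∷ []) ∷ (0F ∷ [])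
                     ∷ (1F ∷ []) ∷ (1F ∷ []) ∷ [])
  ; o      = lookup (0 ∷ 0 ∷ 1 ∷ 1 ∷ 1 ∷ 1 ∷ [])
  ; exempt = []
  ; plan   = (0F , just 2F) ∷ (1F , just 4F) ∷ (3F , nothing) ∷ (2F , nothing)
             ∷ (5F , nothing) ∷ (4F , nothing) ∷ []
  }

-- 0 has 2-neighbour 1 and neighbours 2, 3 of class 2, with 2-neighbours 4, 5 and 6, 7.
class2Class1Class2 : Shape
class2Class1Class2 = record
  { size-1 = 7
  ; T      = lookup ((1F ∷ 2F ∷ 3F ∷ []) ∷ (0F ∷ []) ∷ (4F ∷ 5F ∷ 0F ∷ []) ∷ (6F ∷ 7F ∷ 0F ∷ [])
                     ∷ (2F ∷ []) ∷ (2F ∷ []) ∷ (3F ∷ []) ∷ (3F ∷ []) ∷ [])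
  ; o      = lookup (0 ∷ 1 ∷ 0 ∷ 0 ∷ 1 ∷ 1 ∷ 1 ∷ 1 ∷ [])
  ; exempt = []
  ; plan   = (3F , just 6F) ∷ (0F , just 4F) ∷ (1F , nothing) ∷ (2F , nothing)
             ∷ (5F , nothing) ∷ (4F , nothing) ∷ (7F , nothing) ∷ (6F , nothing) ∷ []
  }

-- 0 has class 3 with 2-neighbours 1, 2, 3; the other neighbour 4 of 1 has class 1,
-- a neighbour 5 of class 2 with 2-neighbours 6, 7, and a neighbour 8 of class 1 with 2-neighbour 9.
class3NearBusyClass1 : Shape
class3NearBusyClass1 = record
  { size-1 = 9
  ; T      = lookup ((1F ∷ 2F ∷ 3F ∷ []) ∷ (0F ∷ 4F ∷ []) ∷ (0F ∷ []) ∷ (0F ∷ [])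
                     ∷ (1F ∷ 5F ∷ 8F ∷ []) ∷ (6F ∷ 7F ∷ 4F ∷ []) ∷ (5F ∷ []) ∷ (5F ∷ [])
                     ∷ (4F ∷ 9F ∷ []) ∷ (8F ∷ []) ∷ [])
  ; o      = lookup (0 ∷ 0 ∷ 1 ∷ 1 ∷ 0 ∷ 0 ∷ 1 ∷ 1 ∷ 1 ∷ 1 ∷ [])
  ; exempt = (2F , 6F) ∷ (2F , 7F) ∷ (2F , 9F) ∷ (3F , 6F) ∷ (3F , 7F) ∷ (3F , 9F) ∷ []
  ; plan   = (5F , just 6F) ∷ (0F , just 2F) ∷ (8F , nothing) ∷ (9F , nothing) ∷ (4F , nothing)
             ∷ (1F , nothing) ∷ (7F , nothing) ∷ (6F , nothing) ∷ (3F , nothing) ∷ (2F , nothing) ∷ []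
  }

isolated-sound : Shape.Sound isolated
isolated-sound = toWitness {a? = Shape.sound? isolated} tt

twoTwo-sound : Shape.Sound twoTwo
twoTwo-sound = toWitness {a? = Shape.sound? twoTwo} tt

class3NearClass2-sound : Shape.Sound class3NearClass2
class3NearClass2-sound = toWitness {a? = Shape.sound? class3NearClass2} tt

class2Class2-sound : Shape.Sound class2Class2
class2Class2-sound = toWitness {a? = Shape.sound? class2Class2} tt

class2Class1Class2-sound : Shape.Sound class2Class1Class2
class2Class1Class2-sound = toWitness {a? = Shape.sound? class2Class1Class2} tt

class3NearBusyClass1-sound : Shape.Sound class3NearBusyClass1
class3NearBusyClass1-sound = toWitness {a? = Shape.sound? class3NearBusyClass1} tt

lookup-unique-injective : ∀ {A : Set} {xs : List A} → Unique xs →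
  ∀ i j → List.lookup xs i ≡ List.lookup xs j → i ≡ j
lookup-unique-injective (x∉ ∷ u) zero    zero    eq = refl
lookup-unique-injective (x∉ ∷ u) zero    (suc j) eq = contradiction eq (All.lookup x∉ (∈-lookup j))
lookup-unique-injective (x∉ ∷ u) (suc i) zero    eq = contradiction (sym eq) (All.lookup x∉ (∈-lookup i))
lookup-unique-injective (x∉ ∷ u) (suc i) (suc j) eq = cong suc (lookup-unique-injective u i j eq)

unique-map⇒injective : ∀ {A B : Set} (f : A → B) {xs} {ys : List B} → Unique (map f xs ++ ys) →
  ∀ {a b} → a ∈ xs → b ∈ xs → f a ≡ f b → a ≡ b
unique-map⇒injective f (x∉ ∷ u) (here refl) (here refl) eq = refl
unique-map⇒injective f (x∉ ∷ u) (here refl) (there b∈)  eq = contradiction eq (All.lookup x∉ (∈-++⁺ˡ (∈-map⁺ f b∈)))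
unique-map⇒injective f (x∉ ∷ u) (there a∈)  (here refl) eq = contradiction (sym eq) (All.lookup x∉ (∈-++⁺ˡ (∈-map⁺ f a∈)))
unique-map⇒injective f (x∉ ∷ u) (there a∈)  (there b∈)  eq = unique-map⇒injective f u a∈ b∈ eq

∧-true⁻ : ∀ a b → a ∧ b ≡ true → a ≡ true × b ≡ true
∧-true⁻ true true _ = refl , refl

-- Non-backtracking walks in girth 7

module Walks {n : ℕ} (G : Graph n) (girth : GirthAtLeast G 7) where

  adj-sym : ∀ {u v} → adj G u v ≡ true → adj G v u ≡ true
  adj-sym {u} {v} = trans (symmetric G v u)

  adj-irrefl : ∀ {v} → adj G v v ≢ true
  adj-irrefl {v} e with () ← trans (sym e) (irrefl G v)

  -- NB d p x y: a walk of length d from x to y which extends the edge p x without backtracking.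
  data NB : ℕ → Fin n → Fin n → Fin n → Set where
    stop : ∀ {p x} → NB 0 p x x
    step : ∀ {d p x x′ y} → adj G x x′ ≡ true → x′ ≢ p → NB d x x′ y → NB (suc d) p x y

  -- The endpoint y is left out: in a closed walk it equals p, which is put at the head of the list.
  vertices : ∀ {d p x y} → NB d p x y → List (Fin n)
  vertices stop                   = []
  vertices (step {x = x} _ _ w) = x ∷ vertices w

  length-vertices : ∀ {d p x y} (w : NB d p x y) → length (vertices w) ≡ d
  length-vertices stop         = refl
  length-vertices (step _ _ w) = cong suc (length-vertices w)

  prefix : ∀ {d p x y z} (w : NB d p x y) → z ∈ vertices w → ∃[ d′ ] d′ < d × NB d′ p x z
  prefix (step a ne w) (here refl) = 0 , s≤s z≤n , stop
  prefix (step a ne w) (there z∈)  with d′ , lt , w′ ← prefix w z∈ = suc d′ , s≤s lt , step a ne w′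

  consecutive : ∀ {d p x y} → adj G p x ≡ true → (w : NB d p x y) → ∀ i →
    adj G (List.lookup (p ∷ vertices w) (inject₁ i)) (List.lookup (vertices w) i) ≡ true
  consecutive e (step a ne w) zero    = e
  consecutive e (step a ne w) (suc i) = consecutive a w i

  last-adj : ∀ {d p x y} → adj G p x ≡ true → (w : NB d p x y) →
    adj G (List.lookup (p ∷ vertices w) (fromℕ (length (vertices w)))) y ≡ true
  last-adj e stop          = e
  last-adj e (step a ne w) = last-adj a w

  -- A repetition would cut out a closed walk from a proper prefix, and this is shorter by at least
  -- one step; so the bound b suffices for walks up to `suc b`.
  unique-vertices : ∀ b → (∀ {d p x y} → d ≤ b → adj G p x ≡ true → NB d p x y → p ≢ y) →
    ∀ {d p x y} → d ≤ suc b → adj G p x ≡ true → (w : NB d p x y) → Unique (p ∷ vertices w)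
  unique-vertices b noReturn le e stop = [] ∷ []
  unique-vertices b noReturn (s≤s le) e w@(step a ne w′) =
    All.tabulate (λ z∈ → let _ , lt , w″ = prefix w z∈ in
      noReturn (ℕ.≤-trans (ℕ.≤-pred lt) le) e w″)
    ∷ unique-vertices b noReturn (ℕ.m≤n⇒m≤1+n le) a w′

  -- The edge p x and d further steps make at most 6 edges. By induction on the bound nothing
  -- repeats earlier, so a return would be a cycle; its length is at least 3 because of the two
  -- explicit steps.
  noReturn : ∀ b → b ≤ 5 → ∀ {d p x y} → d ≤ b → adj G p x ≡ true → NB d p x y → p ≢ y
  noReturn b       b≤5 le e stop                    refl = adj-irrefl e
  noReturn b       b≤5 le e (step a ne stop)        refl = ne refl
  noReturn (suc b) b≤5 le e w@(step _ _ (step _ _ w′)) refl =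
    girth (length (vertices w)) (s≤s (s≤s (s≤s z≤n)))
      (s≤s (s≤s (ℕ.≤-trans (ℕ.≤-reflexive (length-vertices w)) (ℕ.≤-trans le b≤5))))
      (List.lookup (_ ∷ vertices w))
      ( (λ {i} {j} → lookup-unique-injective
          (unique-vertices b (noReturn b (ℕ.<⇒≤ b≤5)) le e w) i j)
      , consecutive e w
      , last-adj e w )

  -- The edge from y to p, put in front, gives a closed walk of d + 3 edges, at most 6.
  notAdjacent : ∀ {d p x y} → d ≤ 3 → adj G p x ≡ true → NB (suc d) p x y → adj G y p ≢ true
  notAdjacent {d} {p} {x} {y} d≤3 e w@(step a ne w′) e′ =
    noReturn 5 ℕ.≤-refl (s≤s (s≤s d≤3)) e′ (step e x≢y w) refl
    where
    x≢y : x ≢ y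
    x≢y = noReturn 5 ℕ.≤-refl (ℕ.≤-trans d≤3 (ℕ.m≤m+n 3 2)) a w′

  -- If m differs from x, the walk y m p x ... y is closed without backtracking and has d + 5 edges,
  -- at most 6. If m is x, the edge x y contradicts `notAdjacent` one step further on.
  noCommonNeighbour : ∀ {d p x y m} → d ≤ 1 → adj G p x ≡ true → NB (2 + d) p x y →
    adj G p m ≡ true → adj G m y ≢ true
  noCommonNeighbour {d} {p} {x} {y} {m} d≤1 e w@(step a ne w′) pm my with m Fin.≟ x
  ... | yes refl = notAdjacent (ℕ.≤-trans d≤1 (ℕ.m≤m+n 1 2)) a w′ (adj-sym my)
  ... | no m≢x   = noReturn 5 ℕ.≤-refl (ℕ.+-monoʳ-≤ 4 d≤1) (adj-sym my)
    (step (adj-sym pm) (noReturn 5 ℕ.≤-refl (ℕ.+-mono-≤ (ℕ.m≤m+n 2 2) d≤1) e w)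
      (step e (m≢x ∘ sym) w)) refl

-- Squares of induced subgraphs

module Neighbours {n : ℕ} (G : Graph n) (S : Subset n) where

  N : Fin n → List (Fin n)
  N v = filter (λ u → (lookup S u ∧ adj G v u) Bool.≟ true) (allFin n)

  ∈N⁺ : ∀ {u v} → lookup S u ≡ true → adj G v u ≡ true → u ∈ N v
  ∈N⁺ {u} u∈S e = ∈-filter⁺ _ (∈-allFin u) (trans (cong (_∧ _) u∈S) e)

  ∈N⁻ : ∀ {u v} → u ∈ N v → lookup S u ≡ true × adj G v u ≡ true
  ∈N⁻ {u} u∈ = ∧-true⁻ (lookup S u) _ (proj₂ (∈-filter⁻ _ {xs = allFin n} u∈))

  N-sym : ∀ {u v} → lookup S v ≡ true → u ∈ N v → v ∈ N u
  N-sym {u} {v} v∈S u∈ = ∈N⁺ v∈S (trans (symmetric G u v) (proj₂ (∈N⁻ u∈)))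

  N-unique : ∀ v → Unique (N v)
  N-unique v = Unique.filter⁺ _ (Unique.allFin⁺ n)

  length-N≤degree : ∀ v → length (N v) ≤ degree G v
  length-N≤degree v = go (allFin n)
    where
    go : ∀ us → length (filter (λ u → (lookup S u ∧ adj G v u) Bool.≟ true) us)
              ≤ sum (map (λ u → b2n (adj G v u)) us)
    go [] = z≤n
    go (u ∷ us) with lookup S u | adj G v u
    ... | true  | true  = s≤s (go us)
    ... | true  | false = go us
    ... | false | true  = ℕ.m≤n⇒m≤1+n (go us)
    ... | false | false = go us

  -- The middle vertex must lie in `S`: this is the square of the induced subgraph, not the
  -- restriction of the square of G. Deleting vertices may therefore destroy square edges, which
  -- `restSQ` has to rule out.
  SQ : Fin n → Fin n → Set
  SQ u v = u ≢ v × (v ∈ N u ⊎ ∃[ w ] w ∈ N u × v ∈ N w)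

  SQ-sym : ∀ {u v} → lookup S u ≡ true → SQ u v → SQ v u
  SQ-sym u∈S (u≢v , inj₁ v∈)           = u≢v ∘ sym , inj₁ (N-sym u∈S v∈)
  SQ-sym u∈S (u≢v , inj₂ (w , w∈ , v∈)) =
    u≢v ∘ sym , inj₂ (w , N-sym (proj₁ (∈N⁻ w∈)) v∈ , N-sym u∈S w∈)

  Coloring : (Fin n → List ℕ) → Set
  Coloring L = Σ[ c ∈ (Fin n → ℕ) ]
    (∀ v → lookup S v ≡ true → c v ∈ L v) ×
    (∀ u v → lookup S u ≡ true → lookup S v ≡ true → SQ u v → c u ≢ c v)

  -- `N↭` accounts for every neighbour inside `S`, since an unlisted one would block colours that
  -- `listSize` does not count.
  record Embedding (shape : Shape) : Set where
    open Shape shape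
    field
      h         : Fin size → Fin n
      h∈S       : ∀ i → lookup S (h i) ≡ true
      out       : Fin size → List (Fin n)
      N↭        : ∀ i → N (h i) ↭ map h (T i) ++ out i
      length-out : ∀ i → length (out i) ≤ o i
      exempt-ok : All (λ ij → ¬ SQ (h (proj₁ ij)) (h (proj₂ ij))) exempt

-- Extending a colouring over a reducible tree

module Reduction {n : ℕ} (G : Graph n) (Δ≤3 : MaxDegreeAtMost G 3) (girth : GirthAtLeast G 7)
  (L : Fin n → List ℕ) (L-unique : ∀ v → Unique (L v)) (L-length : ∀ v → length (L v) ≡ 6)
  (S : Subset n) where

  open Walks G girth
  open Neighbours G S

  module Reduce (shape : Shape) (sound : Shape.Sound shape) (emb : Embedding shape) where
    open Shape shape
    open Embedding emb

    T-sym : ∀ i → All (λ j → i ∈ T j) (T i)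
    T-sym = proj₁ sound

    o≤1 : ∀ i → o i ≤ 1
    o≤1 = proj₁ (proj₂ sound)

    unique-h : ∀ i → Unique (map h (T i) ++ out i)
    unique-h i = Permutation.Unique-resp-↭ (setoid (Fin n)) (↭⇒↭ₛ (N↭ i)) (N-unique (h i))

    T⇒N : ∀ {i j} → j ∈ T i → h j ∈ N (h i)
    T⇒N {i} j∈ = ∈-resp-↭ (↭-sym (N↭ i)) (∈-++⁺ˡ (∈-map⁺ h j∈))

    N-cases : ∀ {i y} → y ∈ N (h i) → (∃[ j ] j ∈ T i × y ≡ h j) ⊎ y ∈ out i
    N-cases {i} y∈ with ∈-++⁻ (map h (T i)) (∈-resp-↭ (N↭ i) y∈)
    ... | inj₁ y∈T = inj₁ (∈-map⁻ h y∈T)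
    ... | inj₂ y∈o = inj₂ y∈o

    out⊆N : ∀ {i y} → y ∈ out i → y ∈ N (h i)
    out⊆N {i} y∈ = ∈-resp-↭ (↭-sym (N↭ i)) (∈-++⁺ʳ (map h (T i)) y∈)

    ends-walk : ∀ d p x {y} → p ∈ T x → y ∈ ends d p x → NB d (h p) (h x) (h y)
    ends-walk zero    p x p∈ (here refl) = stop
    ends-walk (suc d) p x p∈ y∈
      with z , z∈ , y∈z ← find (∈-concatMap⁻ (ends d x) {xs = filter (λ y → ¬? (y Fin.≟ p)) (T x)} y∈)
      with z∈T , z≢p ← ∈-filter⁻ _ {xs = T x} z∈ =
      step (proj₂ (∈N⁻ (T⇒N z∈T))) (z≢p ∘ unique-map⇒injective h (unique-h x) z∈T p∈)
        (ends-walk d x z (All.lookup (T-sym x) z∈T) y∈z)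

    notSQ : ∀ {d p x y} → d ≤ 1 → adj G p x ≡ true → NB (2 + d) p x y → ¬ SQ p y
    notSQ d≤1 e w (_ , inj₁ y∈) =
      notAdjacent (s≤s (ℕ.≤-trans d≤1 (s≤s z≤n))) e w (adj-sym (proj₂ (∈N⁻ y∈)))
    notSQ d≤1 e w (_ , inj₂ (m , m∈ , y∈)) =
      noCommonNeighbour d≤1 e w (proj₂ (∈N⁻ m∈)) (proj₂ (∈N⁻ y∈))

    far-notSQ : ∀ i {j} → j ∈ far i → ¬ SQ (h i) (h j)
    far-notSQ i j∈ with x , x∈ , j∈x ← find (∈-concatMap⁻ (λ x → ends 2 i x ++ ends 3 i x) {xs = T i} j∈)
      with ∈-++⁻ (ends 2 i x) j∈x
    ... | inj₁ j∈2 = notSQ z≤n (proj₂ (∈N⁻ (T⇒N x∈))) (ends-walk 2 i x (All.lookup (T-sym i) x∈) j∈2)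
    ... | inj₂ j∈3 = notSQ ℕ.≤-refl (proj₂ (∈N⁻ (T⇒N x∈))) (ends-walk 3 i x (All.lookup (T-sym i) x∈) j∈3)

    SQ⇒close : ∀ i j → i ≢ j → SQ (h i) (h j) → close i j ≡ true
    SQ⇒close i j i≢j sq with proj₁ (proj₂ (proj₂ sound)) i j
    ... | inj₁ eq                             = contradiction eq i≢j
    ... | inj₂ (inj₁ e)                       = e
    ... | inj₂ (inj₂ (inj₁ j∈))               = contradiction sq (far-notSQ i j∈)
    ... | inj₂ (inj₂ (inj₂ (inj₁ ij∈)))       = contradiction sq (All.lookup exempt-ok ij∈)
    ... | inj₂ (inj₂ (inj₂ (inj₂ ji∈)))       = contradiction (SQ-sym (h∈S i) sq) (All.lookup exempt-ok ji∈)

    inH? : ∀ v → Dec (∃[ i ] v ≡ h i)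
    inH? v = Fin.any? (λ i → v Fin.≟ h i)

    rest : Subset n
    rest = tabulate (λ v → lookup S v ∧ not ⌊ inH? v ⌋)

    rest⁻ : ∀ {v} → lookup rest v ≡ true → lookup S v ≡ true × ¬ (∃[ i ] v ≡ h i)
    rest⁻ {v} e rewrite Vec.lookup∘tabulate (λ v → lookup S v ∧ not ⌊ inH? v ⌋) v with lookup S v | inH? v
    ... | true | no ¬H = refl , ¬H

    rest⁺ : ∀ {v} → lookup S v ≡ true → ¬ (∃[ i ] v ≡ h i) → lookup rest v ≡ true
    rest⁺ {v} v∈S ¬H rewrite Vec.lookup∘tabulate (λ v → lookup S v ∧ not ⌊ inH? v ⌋) v | v∈S with inH? v
    ... | yes inH = contradiction inH ¬H
    ... | no  _   = refl

    rest⊂S : rest ⊂ S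
    rest⊂S = (λ x∈ → Vec.lookup⇒[]= _ S (proj₁ (rest⁻ (Vec.[]=⇒lookup x∈))))
           , h zero , Vec.lookup⇒[]= _ S (h∈S zero)
           , λ h∈ → proj₂ (rest⁻ (Vec.[]=⇒lookup h∈)) (zero , refl)

    module Rest = Neighbours G rest

    others : Fin n → Fin size → List (Fin n)
    others y i = filter (λ z → ¬? (z Fin.≟ h i)) (N y)

    -- Covers all vertices outside the tree that constrain `h i`. The first two blocks account for
    -- the term 3 * o i of `listSize`, the last one for the sum over the tree neighbours.
    outerSquare : Fin size → List (Fin n)
    outerSquare i = (out i ++ concatMap (λ y → others y i) (out i)) ++ concatMap out (T i)

    SQ⇒outerSquare : ∀ {i v} → ¬ (∃[ j ] v ≡ h j) → SQ (h i) v → v ∈ outerSquare i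
    SQ⇒outerSquare {i} {v} v∉H (_ , inj₁ v∈) with N-cases v∈
    ... | inj₁ (j , _ , eq) = contradiction (j , eq) v∉H
    ... | inj₂ v∈out        = ∈-++⁺ˡ (∈-++⁺ˡ v∈out)
    SQ⇒outerSquare {i} {v} v∉H (h≢v , inj₂ (w , w∈ , v∈)) with N-cases w∈
    ... | inj₂ w∈out = ∈-++⁺ˡ (∈-++⁺ʳ (out i) (∈-concatMap⁺ (λ y → others y i)
            (lose w∈out (∈-filter⁺ _ v∈ (h≢v ∘ sym)))))
    ... | inj₁ (j , j∈ , refl) with N-cases v∈
    ... | inj₁ (j′ , _ , eq) = contradiction (j′ , eq) v∉H
    ... | inj₂ v∈out         = ∈-++⁺ʳ (out i ++ concatMap (λ y → others y i) (out i))
            (∈-concatMap⁺ out (lose j∈ v∈out))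

    length-others : ∀ {i y} → y ∈ out i → length (others y i) ≤ 2
    length-others {i} {y} y∈ = ℕ.≤-pred (ℕ.≤-trans
      (filter-notAll (λ z → ¬? (z Fin.≟ h i)) (N y)
        (lose (N-sym (h∈S i) (out⊆N y∈)) (λ ne → ne refl)))
      (ℕ.≤-trans (length-N≤degree y) (Δ≤3 y)))

    length-concatMap-others : ∀ i ys → (∀ {y} → y ∈ ys → y ∈ out i) →
      length (concatMap (λ y → others y i) ys) ≤ 2 * length ys
    length-concatMap-others i []       sub = z≤n
    length-concatMap-others i (y ∷ ys) sub = begin
      length (others y i ++ concatMap (λ y → others y i) ys)        ≡⟨ length-++ (others y i) ⟩
      length (others y i) + length (concatMap (λ y → others y i) ys) ≤⟨ ℕ.+-mono-≤ (length-others (sub (here refl)))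
                                                                          (length-concatMap-others i ys (sub ∘ there)) ⟩
      2 + 2 * length ys                                             ≡⟨ ℕ.*-suc 2 (length ys) ⟨
      2 * suc (length ys)                                           ∎
      where open ℕ.≤-Reasoning

    length-concatMap-out : ∀ is → length (concatMap out is) ≤ sum (map o is)
    length-concatMap-out []       = z≤n
    length-concatMap-out (i ∷ is) = ℕ.≤-trans (ℕ.≤-reflexive (length-++ (out i)))
      (ℕ.+-mono-≤ (length-out i) (length-concatMap-out is))

    length-outerSquare : ∀ i → length (outerSquare i) ≤ 3 * o i + sum (map o (T i))
    length-outerSquare i = begin
      length (outerSquare i)
        ≡⟨ length-++ (out i ++ concatMap (λ y → others y i) (out i)) ⟩
      length (out i ++ concatMap (λ y → others y i) (out i)) + length (concatMap out (T i))
        ≡⟨ cong (_+ length (concatMap out (T i))) (length-++ (out i)) ⟩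
      length (out i) + length (concatMap (λ y → others y i) (out i)) + length (concatMap out (T i))
        ≤⟨ ℕ.+-mono-≤ (ℕ.+-monoʳ-≤ (length (out i)) (length-concatMap-others i (out i) (λ y∈ → y∈)))
             (length-concatMap-out (T i)) ⟩
      3 * length (out i) + sum (map o (T i))
        ≤⟨ ℕ.+-monoˡ-≤ (sum (map o (T i))) (ℕ.*-monoʳ-≤ 3 (length-out i)) ⟩
      3 * o i + sum (map o (T i)) ∎
      where open ℕ.≤-Reasoning

    extend : Rest.Coloring L → Coloring L
    extend (c₀ , c₀∈L , c₀-proper) = c , c∈L , proper
      where
      free : Fin size → List ℕ
      free i = delAll (map c₀ (outerSquare i)) (L (h i))

      free-unique : ∀ i → Unique (free i)
      free-unique i = delAll-unique (map c₀ (outerSquare i)) (L-unique (h i))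

      listSize≤ : ∀ i → listSize i ≤ length (free i)
      listSize≤ i = ℕ.m≤n+o⇒m∸n≤o 6 _ (begin
        6                                                   ≡⟨ L-length (h i) ⟨
        length (L (h i))                                    ≤⟨ length-delAll (map c₀ (outerSquare i)) (L-unique (h i)) ⟩
        length (map c₀ (outerSquare i)) + length (free i)   ≡⟨ cong (_+ length (free i)) (length-map c₀ (outerSquare i)) ⟩
        length (outerSquare i) + length (free i)            ≤⟨ ℕ.+-monoˡ-≤ (length (free i)) (length-outerSquare i) ⟩
        3 * o i + sum (map o (T i)) + length (free i)       ∎)
        where open ℕ.≤-Reasoning

      colored = greedy close plan listSize (proj₂ (proj₂ (proj₂ (proj₂ sound))))
        (λ i → take (listSize i) (free i))
        (λ i → Unique.take⁺ (listSize i) (free-unique i))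
        (λ i → trans (length-take (listSize i) (free i)) (ℕ.m≤n⇒m⊓n≡m (listSize≤ i)))

      planned-all : ∀ i → i ∈ planned plan
      planned-all = proj₁ (proj₂ (proj₂ (proj₂ sound)))

      cH : Fin size → ℕ
      cH = proj₁ colored

      cH∈free : ∀ i → cH i ∈ free i
      cH∈free i = ∈-take⁻ (listSize i) (free i) (proj₁ (proj₂ colored) i (planned-all i))

      cH≢c₀ : ∀ {i v} → ¬ (∃[ j ] v ≡ h j) → SQ (h i) v → cH i ≢ c₀ v
      cH≢c₀ {i} {v} v∉H sq eq = proj₂ (∈-delAll⁻ (map c₀ (outerSquare i)) (cH∈free i))
        (subst (_∈ map c₀ (outerSquare i)) (sym eq) (∈-map⁺ c₀ (SQ⇒outerSquare v∉H sq)))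

      c : Fin n → ℕ
      c v with inH? v
      ... | yes (i , _) = cH i
      ... | no  _       = c₀ v

      c∈L : ∀ v → lookup S v ≡ true → c v ∈ L v
      c∈L v v∈S with inH? v
      ... | yes (i , refl) = proj₁ (∈-delAll⁻ (map c₀ (outerSquare i)) (cH∈free i))
      ... | no v∉H         = c₀∈L v (rest⁺ v∈S v∉H)

      -- A square edge can get lost only if its middle vertex lies in the tree. Then u and v are
      -- both outer neighbours of that vertex, hence equal by `o≤1`.
      restSQ : ∀ {u v} → lookup S u ≡ true → ¬ (∃[ i ] u ≡ h i) → ¬ (∃[ i ] v ≡ h i) → SQ u v → Rest.SQ u v
      restSQ u∈S u∉H v∉H (u≢v , inj₁ v∈) with v∈S , e ← ∈N⁻ v∈ =
        u≢v , inj₁ (Rest.∈N⁺ (rest⁺ v∈S v∉H) e)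
      restSQ {u} {v} u∈S u∉H v∉H (u≢v , inj₂ (w , w∈ , v∈)) with inH? w
      ... | no w∉H = u≢v , inj₂ (w , Rest.∈N⁺ (rest⁺ (proj₁ (∈N⁻ w∈)) w∉H) (proj₂ (∈N⁻ w∈))
                                   , Rest.∈N⁺ (rest⁺ (proj₁ (∈N⁻ v∈)) v∉H) (proj₂ (∈N⁻ v∈)))
      ... | yes (i , refl) with N-cases (N-sym u∈S w∈) | N-cases v∈
      ... | inj₁ (j , _ , eq) | _                 = contradiction (j , eq) u∉H
      ... | inj₂ _            | inj₁ (j , _ , eq) = contradiction (j , eq) v∉H
      ... | inj₂ u∈out        | inj₂ v∈out        =
        contradiction (atMostOne u∈out v∈out (ℕ.≤-trans (length-out i) (o≤1 i))) u≢v
        where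
        atMostOne : ∀ {xs} → u ∈ xs → v ∈ xs → length xs ≤ 1 → u ≡ v
        atMostOne (here refl) (here refl) _ = refl
        atMostOne {_ ∷ _ ∷ _} _ _ (s≤s ())

      proper : ∀ u v → lookup S u ≡ true → lookup S v ≡ true → SQ u v → c u ≢ c v
      proper u v u∈S v∈S sq with inH? u | inH? v
      ... | yes (i , refl) | yes (j , refl) = proj₂ (proj₂ colored) i j (planned-all i) (planned-all j) i≢j
              (SQ⇒close i j i≢j sq) (SQ⇒close j i (i≢j ∘ sym) (SQ-sym u∈S sq))
              where
              i≢j : i ≢ j
              i≢j refl = proj₁ sq refl
      ... | yes (i , refl) | no v∉H         = cH≢c₀ v∉H sq
      ... | no u∉H         | yes (j , refl) = cH≢c₀ u∉H (SQ-sym u∈S sq) ∘ sym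
      ... | no u∉H         | no v∉H         =
        c₀-proper u v (rest⁺ u∈S u∉H) (rest⁺ v∈S v∉H) (restSQ u∈S u∉H v∉H sq)

-- Lists up to permutation

∈⇒↭∷ : ∀ {A : Set} {x : A} {xs} → x ∈ xs → ∃[ ys ] xs ↭ x ∷ ys
∈⇒↭∷ {x = x} x∈ with ys , zs , refl ← ∈-∃++ x∈ = ys ++ zs , shift x ys zs

filter-↭-split : ∀ {A : Set} {P : A → Set} (P? : ∀ x → Dec (P x)) xs →
  xs ↭ filter P? xs ++ filter (λ x → ¬? (P? x)) xs
filter-↭-split P? [] = ↭-refl
filter-↭-split P? (x ∷ xs) with P? x
... | yes _ = ↭-prep x (filter-↭-split P? xs)
... | no  _ = ↭-trans (↭-prep x (filter-↭-split P? xs))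
                (↭-sym (shift x (filter P? xs) (filter (λ x → ¬? (P? x)) xs)))

distinct⇒2≤length : ∀ {A : Set} {x y : A} {xs} → x ∈ xs → y ∈ xs → x ≢ y → 2 ≤ length xs
distinct⇒2≤length {xs = _ ∷ []}     (here refl) (here refl) x≢y = contradiction refl x≢y
distinct⇒2≤length {xs = _ ∷ _ ∷ _} _           _           x≢y = s≤s (s≤s z≤n)

another : ∀ {n} {xs : List (Fin n)} x → Unique xs → 2 ≤ length xs → ∃[ y ] y ∈ xs × y ≢ x
another {xs = p ∷ q ∷ _} x ((p≢q ∷ _) ∷ _) le with p Fin.≟ x
... | no p≢x   = p , here refl , p≢x
... | yes refl = q , there (here refl) , p≢q ∘ sym
another {xs = _ ∷ []} x _ (s≤s ())

-- Kinds of vertices and the discharging rule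

-- two: degree 2; cᵢ: degree 3 with exactly i neighbours of degree 2.
data Kind : Set where
  two c0 c1 c2 c3 : Kind

-- Only degrees 2 and 3 occur, by `2≤deg` and `deg≤3`; the clauses after the first are meant for
-- degree 3.
kindOf : ℕ → ℕ → Kind
kindOf 2 _ = two
kindOf _ 0 = c0
kindOf _ 1 = c1
kindOf _ 2 = c2
kindOf _ _ = c3

_≟c3 : ∀ k → Dec (k ≡ c3)
two ≟c3 = no λ ()
c0  ≟c3 = no λ ()
c1  ≟c3 = no λ ()
c2  ≟c3 = no λ ()
c3  ≟c3 = yes refl

_≟c2 : ∀ k → Dec (k ≡ c2)
two ≟c2 = no λ ()
c0  ≟c2 = no λ ()
c1  ≟c2 = no λ ()
c2  ≟c2 = yes refl
c3  ≟c2 = no λ ()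

-- Amount sent to a neighbour; the flag tells whether the receiver has a neighbour of kind c3.
give : Kind → Kind → Bool → ℕ
give two _   _     = 0
give c3  two _     = 1
give _   two false = 2
give _   two true  = 3
give c0  _   _     = 1
give c1  c2  _     = 1
give _   _   _     = 0

give-to-two : ∀ {k l} b → k ≢ two → k ≢ c3 → l ≡ two → 2 ≤ give k l b
give-to-two {two} b     k≢two k≢c3 refl = contradiction refl k≢two
give-to-two {c0}  true  k≢two k≢c3 refl = s≤s (s≤s z≤n)
give-to-two {c0}  false k≢two k≢c3 refl = ℕ.≤-refl
give-to-two {c1}  true  k≢two k≢c3 refl = s≤s (s≤s z≤n)
give-to-two {c1}  false k≢two k≢c3 refl = ℕ.≤-refl
give-to-two {c2}  true  k≢two k≢c3 refl = s≤s (s≤s z≤n)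
give-to-two {c2}  false k≢two k≢c3 refl = ℕ.≤-refl
give-to-two {c3}  b     k≢two k≢c3 refl = contradiction refl k≢c3

give-to-flagged-two : ∀ {k l b} → k ≢ two → k ≢ c3 → l ≡ two → b ≡ true → 3 ≤ give k l b
give-to-flagged-two {two} k≢two k≢c3 refl refl = contradiction refl k≢two
give-to-flagged-two {c0}  k≢two k≢c3 refl refl = ℕ.≤-refl
give-to-flagged-two {c1}  k≢two k≢c3 refl refl = ℕ.≤-refl
give-to-flagged-two {c2}  k≢two k≢c3 refl refl = ℕ.≤-refl
give-to-flagged-two {c3}  k≢two k≢c3 refl refl = contradiction refl k≢c3

give-from-two : ∀ {k} l b → k ≡ two → give k l b ≤ 0
give-from-two l b refl = z≤n

give-from-c0 : ∀ {k l} b → k ≡ c0 → l ≢ two → give k l b ≤ 1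
give-from-c0 {l = two} b refl l≢two = contradiction refl l≢two
give-from-c0 {l = c0}  b refl l≢two = ℕ.≤-refl
give-from-c0 {l = c1}  b refl l≢two = ℕ.≤-refl
give-from-c0 {l = c2}  b refl l≢two = ℕ.≤-refl
give-from-c0 {l = c3}  b refl l≢two = ℕ.≤-refl

give-from-c1 : ∀ {k l} b → k ≡ c1 → l ≢ two → l ≢ c2 → give k l b ≤ 0
give-from-c1 {l = two} b refl l≢two l≢c2 = contradiction refl l≢two
give-from-c1 {l = c0}  b refl l≢two l≢c2 = z≤n
give-from-c1 {l = c1}  b refl l≢two l≢c2 = z≤n
give-from-c1 {l = c2}  b refl l≢two l≢c2 = contradiction refl l≢c2
give-from-c1 {l = c3}  b refl l≢two l≢c2 = z≤n

give-from-c2 : ∀ {k l} b → k ≡ c2 → l ≢ two → give k l b ≤ 0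
give-from-c2 {l = two} b refl l≢two = contradiction refl l≢two
give-from-c2 {l = c0}  b refl l≢two = z≤n
give-from-c2 {l = c1}  b refl l≢two = z≤n
give-from-c2 {l = c2}  b refl l≢two = z≤n
give-from-c2 {l = c3}  b refl l≢two = z≤n

give-two≤3 : ∀ k {l} b → l ≡ two → give k l b ≤ 3
give-two≤3 two b     refl = z≤n
give-two≤3 c3  b     refl = s≤s z≤n
give-two≤3 c0  true  refl = ℕ.≤-refl
give-two≤3 c0  false refl = ℕ.n≤1+n 2
give-two≤3 c1  true  refl = ℕ.≤-refl
give-two≤3 c1  false refl = ℕ.n≤1+n 2
give-two≤3 c2  true  refl = ℕ.≤-refl
give-two≤3 c2  false refl = ℕ.n≤1+n 2

give-unflagged-two≤2 : ∀ k {l b} → l ≡ two → b ≡ false → give k l b ≤ 2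
give-unflagged-two≤2 two refl refl = z≤n
give-unflagged-two≤2 c0  refl refl = ℕ.≤-refl
give-unflagged-two≤2 c1  refl refl = ℕ.≤-refl
give-unflagged-two≤2 c2  refl refl = ℕ.≤-refl
give-unflagged-two≤2 c3  refl refl = s≤s z≤n

give-c3-two : ∀ {k l} b → k ≡ c3 → l ≡ two → give k l b ≡ 1
give-c3-two b refl refl = refl

give-c1-c2 : ∀ {k l} b → k ≡ c1 → l ≡ c2 → give k l b ≡ 1
give-c1-c2 b refl refl = refl

give-to-c2 : ∀ {k l} b → k ≡ c0 ⊎ k ≡ c1 → l ≡ c2 → 1 ≤ give k l b
give-to-c2 b (inj₁ refl) refl = ℕ.≤-refl
give-to-c2 b (inj₂ refl) refl = ℕ.≤-refl

give-c0-c1 : ∀ {k l} b → k ≡ c0 → l ≡ c1 → 1 ≤ give k l b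
give-c0-c1 b refl refl = ℕ.≤-refl

-- Neighbourhoods in an irreducible subgraph

module Discharging {n : ℕ} (G : Graph n) (Δ≤3 : MaxDegreeAtMost G 3) (girth : GirthAtLeast G 7)
  (S : Subset n)
  (irreducible : ∀ shape → Shape.Sound shape → ¬ Neighbours.Embedding G S shape) where

  open Walks G girth
  open Neighbours G S

  deg : Fin n → ℕ
  deg v = length (N v)

  twos : Fin n → List (Fin n)
  twos v = filter (λ u → deg u ℕ.≟ 2) (N v)

  threes : Fin n → List (Fin n)
  threes v = filter (λ u → ¬? (deg u ℕ.≟ 2)) (N v)

  kind : Fin n → Kind
  kind v = kindOf (deg v) (length (twos v))

  deg≤3 : ∀ v → deg v ≤ 3
  deg≤3 v = ℕ.≤-trans (length-N≤degree v) (Δ≤3 v)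

  N⊆S : ∀ {u v} → u ∈ N v → lookup S u ≡ true
  N⊆S u∈ = proj₁ (∈N⁻ u∈)

  -- Otherwise v alone is a reducible tree: a single outer neighbour blocks at most 3 of the 6
  -- colours.
  2≤deg : ∀ {v} → lookup S v ≡ true → 2 ≤ deg v
  2≤deg {v} v∈S with 2 ℕ.≤? deg v
  ... | yes le = le
  ... | no ¬le = contradiction emb (irreducible isolated isolated-sound)
    where
    emb : Embedding isolated
    emb = record
      { h = λ _ → v ; h∈S = λ _ → v∈S ; out = λ _ → N v ; N↭ = λ _ → ↭-refl
      ; length-out = λ _ → ℕ.≤-pred (ℕ.≰⇒> ¬le) ; exempt-ok = [] }

  twos⁻ : ∀ {u v} → u ∈ twos v → u ∈ N v × deg u ≡ 2
  twos⁻ {v = v} = ∈-filter⁻ _ {xs = N v}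

  threes⁻ : ∀ {u v} → u ∈ threes v → u ∈ N v × deg u ≢ 2
  threes⁻ {v = v} = ∈-filter⁻ _ {xs = N v}

  twos⁺ : ∀ {u v} → u ∈ N v → deg u ≡ 2 → u ∈ twos v
  twos⁺ = ∈-filter⁺ _

  split : ∀ v → N v ↭ twos v ++ threes v
  split v = filter-↭-split (λ u → deg u ℕ.≟ 2) (N v)

  deg2⇒N↭ : ∀ {u v} → deg v ≡ 2 → u ∈ N v → ∃[ w ] N v ↭ u ∷ w ∷ []
  deg2⇒N↭ {u} {v} d u∈ with ∈⇒↭∷ u∈
  ... | []         , p with () ← trans (sym d) (↭-length p)
  ... | w ∷ []     , p = w , p
  ... | _ ∷ _ ∷ _ , p with () ← trans (sym d) (↭-length p)

  no-twoTwo : ∀ {u v} → lookup S u ≡ true → v ∈ N u → deg u ≡ 2 → deg v ≢ 2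
  no-twoTwo {u} {v} u∈S v∈ du dv
    with u′ , pu ← deg2⇒N↭ du v∈ | v′ , pv ← deg2⇒N↭ dv (N-sym u∈S v∈) =
    irreducible twoTwo twoTwo-sound (record
      { h = lookup (u ∷ v ∷ [])
      ; h∈S = λ { 0F → u∈S ; 1F → N⊆S v∈ }
      ; out = lookup ((u′ ∷ []) ∷ (v′ ∷ []) ∷ [])
      ; N↭ = λ { 0F → pu ; 1F → pv }
      ; length-out = λ { 0F → ℕ.≤-refl ; 1F → ℕ.≤-refl }
      ; exempt-ok = [] })

  data View (v : Fin n) : Kind → Set where
    two : ∀ {x y} → N v ↭ x ∷ y ∷ [] → deg x ≢ 2 → deg y ≢ 2 → View v two
    c0  : ∀ {x y z} → N v ↭ x ∷ y ∷ z ∷ [] → deg x ≢ 2 → deg y ≢ 2 → deg z ≢ 2 → View v c0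
    c1  : ∀ {x y z} → N v ↭ x ∷ y ∷ z ∷ [] → deg x ≡ 2 → deg y ≢ 2 → deg z ≢ 2 → View v c1
    c2  : ∀ {x y z} → N v ↭ x ∷ y ∷ z ∷ [] → deg x ≡ 2 → deg y ≡ 2 → deg z ≢ 2 → View v c2
    c3  : ∀ {x y z} → N v ↭ x ∷ y ∷ z ∷ [] → deg x ≡ 2 → deg y ≡ 2 → deg z ≡ 2 → View v c3

  view : ∀ {v} → lookup S v ≡ true → View v (kind v)
  view {v} v∈S = go (deg v) (twos v) (threes v) refl (↭-length (split v)) (split v)
    (λ u∈ → proj₂ (twos⁻ u∈)) (λ u∈ → proj₂ (threes⁻ u∈)) (2≤deg v∈S) (deg≤3 v)
    where
    go : ∀ d ts hs → deg v ≡ d → d ≡ length (ts ++ hs) → N v ↭ ts ++ hs →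
         (∀ {u} → u ∈ ts → deg u ≡ 2) → (∀ {u} → u ∈ hs → deg u ≢ 2) →
         2 ≤ d → d ≤ 3 → View v (kindOf d (length ts))
    go _ [] (x ∷ y ∷ []) d refl p t h lo hi         = two p (h (here refl)) (h (there (here refl)))
    go _ [] (x ∷ y ∷ z ∷ []) d refl p t h lo hi     =
      c0 p (h (here refl)) (h (there (here refl))) (h (there (there (here refl))))
    go _ (x ∷ []) (y ∷ z ∷ []) d refl p t h lo hi   =
      c1 p (t (here refl)) (h (here refl)) (h (there (here refl)))
    go _ (x ∷ y ∷ []) (z ∷ []) d refl p t h lo hi   =
      c2 p (t (here refl)) (t (there (here refl))) (h (here refl))
    go _ (x ∷ y ∷ z ∷ []) [] d refl p t h lo hi     =
      c3 p (t (here refl)) (t (there (here refl))) (t (there (there (here refl))))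
    go _ (x ∷ []) (y ∷ []) d refl p t h lo hi       =
      contradiction (t (here refl)) (no-twoTwo v∈S (∈-resp-↭ (↭-sym p) (here refl)) d)
    go _ (x ∷ y ∷ []) [] d refl p t h lo hi         =
      contradiction (t (here refl)) (no-twoTwo v∈S (∈-resp-↭ (↭-sym p) (here refl)) d)
    go _ [] [] d refl p t h () hi
    go _ [] (_ ∷ []) d refl p t h (s≤s ()) hi
    go _ (_ ∷ []) [] d refl p t h (s≤s ()) hi
    go _ [] (_ ∷ _ ∷ _ ∷ _ ∷ _) d refl p t h lo (s≤s (s≤s (s≤s ())))
    go _ (_ ∷ []) (_ ∷ _ ∷ _ ∷ _) d refl p t h lo (s≤s (s≤s (s≤s ())))
    go _ (_ ∷ _ ∷ []) (_ ∷ _ ∷ _) d refl p t h lo (s≤s (s≤s (s≤s ())))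
    go _ (_ ∷ _ ∷ _ ∷ []) (_ ∷ _) d refl p t h lo (s≤s (s≤s (s≤s ())))
    go _ (_ ∷ _ ∷ _ ∷ _ ∷ _) hs d refl p t h lo (s≤s (s≤s (s≤s ())))

  viewAs : ∀ {v k} → lookup S v ≡ true → kind v ≡ k → View v k
  viewAs v∈S refl = view v∈S

  kind≡two⇒deg : ∀ {v} → kind v ≡ two → deg v ≡ 2
  kind≡two⇒deg {v} = go (deg v) (length (twos v))
    where
    go : ∀ d t → kindOf d t ≡ two → d ≡ 2
    go 2 t e = refl
    go 0 0 ()
    go 0 1 ()
    go 0 2 ()
    go 0 (suc (suc (suc _))) ()
    go 1 0 ()
    go 1 1 ()
    go 1 2 ()
    go 1 (suc (suc (suc _))) ()
    go (suc (suc (suc _))) 0 ()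
    go (suc (suc (suc _))) 1 ()
    go (suc (suc (suc _))) 2 ()
    go (suc (suc (suc _))) (suc (suc (suc _))) ()

  deg⇒kind≡two : ∀ {v} → deg v ≡ 2 → kind v ≡ two
  deg⇒kind≡two {v} d rewrite d = refl

  c3⇒twos : ∀ {v} → lookup S v ≡ true → kind v ≡ c3 → ∀ {u} → u ∈ N v → deg u ≡ 2
  c3⇒twos v∈S k u∈ with viewAs v∈S k
  ... | c3 p dx dy dz with ∈-resp-↭ p u∈
  ... | here refl                 = dx
  ... | there (here refl)         = dy
  ... | there (there (here refl)) = dz

  c3⇒N↭ : ∀ {v a} → lookup S v ≡ true → kind v ≡ c3 → a ∈ N v →
    ∃[ b ] ∃[ c ] N v ↭ a ∷ b ∷ c ∷ []
  c3⇒N↭ v∈S k a∈ with viewAs v∈S k | ∈⇒↭∷ a∈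
  ... | c3 p _ _ _ | []             , q with () ← trans (sym (↭-length p)) (↭-length q)
  ... | c3 p _ _ _ | _ ∷ []         , q with () ← trans (sym (↭-length p)) (↭-length q)
  ... | c3 p _ _ _ | _ ∷ _ ∷ _ ∷ _ , q with () ← trans (sym (↭-length p)) (↭-length q)
  ... | c3 p _ _ _ | b ∷ c ∷ []     , q = b , c , q

  c2⇒N↭ : ∀ {u v} → lookup S u ≡ true → kind u ≡ c2 → v ∈ N u → deg v ≢ 2 →
    ∃[ a ] ∃[ b ] N u ↭ a ∷ b ∷ v ∷ [] × deg a ≡ 2 × deg b ≡ 2
  c2⇒N↭ u∈S k v∈ dv with viewAs u∈S k
  ... | c2 p dx dy dz with ∈-resp-↭ p v∈
  ... | here refl                 = contradiction dx dv
  ... | there (here refl)         = contradiction dy dv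
  ... | there (there (here refl)) = _ , _ , p , dx , dy

  c1⇒N↭ : ∀ {u v} → lookup S u ≡ true → kind u ≡ c1 → v ∈ N u → deg v ≢ 2 →
    ∃[ q ] ∃[ z ] N u ↭ v ∷ q ∷ z ∷ [] × deg q ≡ 2
  c1⇒N↭ u∈S k v∈ dv with viewAs u∈S k
  ... | c1 {x} {y} {z} p dx dy dz with ∈-resp-↭ p v∈
  ... | here refl                 = contradiction dx dv
  ... | there (here refl)         = x , z , ↭-trans p (↭-swap x y ↭-refl) , dx
  ... | there (there (here refl)) = x , y , ↭-trans p (shift z (x ∷ y ∷ []) []) , dx

  2≤twos⇒N↭ : ∀ {v a} → 2 ≤ length (twos v) → a ∈ N v →
    ∃[ d ] ∃[ rs ] N v ↭ a ∷ d ∷ rs × deg d ≡ 2 × length rs ≤ 1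
  2≤twos⇒N↭ {v} {a} le a∈
    with d , d∈ , d≢a ← another a (Unique.filter⁺ _ (N-unique v)) le
    with ys , p ← ∈⇒↭∷ a∈
    with ∈-resp-↭ p (proj₁ (twos⁻ {v = v} d∈))
  ... | here d≡a = contradiction d≡a d≢a
  ... | there d∈ys with zs , q ← ∈⇒↭∷ d∈ys =
    d , zs , p′ , proj₂ (twos⁻ {v = v} d∈) , ℕ.≤-pred (ℕ.≤-pred (ℕ.≤-trans (ℕ.≤-reflexive (sym (↭-length p′))) (deg≤3 v)))
    where p′ = ↭-trans p (↭-prep a q)

  2≤twos : ∀ {v x y zs} → N v ↭ x ∷ y ∷ zs → deg x ≡ 2 → deg y ≡ 2 → 2 ≤ length (twos v)
  2≤twos {v} {x} {y} p dx dy = distinct⇒2≤length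
    (twos⁺ (∈-resp-↭ (↭-sym p) (here refl)) dx)
    (twos⁺ (∈-resp-↭ (↭-sym p) (there (here refl))) dy)
    (head≢ (Permutation.Unique-resp-↭ (setoid (Fin n)) (↭⇒↭ₛ p) (N-unique v)))
    where
    head≢ : ∀ {zs} → Unique (x ∷ y ∷ zs) → x ≢ y
    head≢ ((ne ∷ _) ∷ _) = ne

  c2⇒2≤twos : ∀ {v} → lookup S v ≡ true → kind v ≡ c2 → 2 ≤ length (twos v)
  c2⇒2≤twos v∈S k with viewAs v∈S k
  ... | c2 p dx dy _ = 2≤twos p dx dy

  c3⇒2≤twos : ∀ {v} → lookup S v ≡ true → kind v ≡ c3 → 2 ≤ length (twos v)
  c3⇒2≤twos v∈S k with viewAs v∈S k
  ... | c3 p dx dy _ = 2≤twos p dx dy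

  -- Counting `twos` treats classes 2 and 3 of w alike. This serves three times: for a 2-vertex
  -- between two class 3 vertices, for a flagged 2-neighbour of class 2, and for the exempt pairs.
  c3-two-2≤twos : ∀ {v a w} → lookup S v ≡ true → kind v ≡ c3 → a ∈ N v → w ∈ N a → w ≢ v →
    ¬ 2 ≤ length (twos w)
  c3-two-2≤twos {v} {a} {w} v∈S kv a∈ w∈ w≢v le
    with b , c , pv ← c3⇒N↭ v∈S kv a∈
    with da ← c3⇒twos v∈S kv a∈
    with a∈S ← N⊆S a∈ | w∈S ← N⊆S w∈
    with w′ , pa ← deg2⇒N↭ da (N-sym v∈S a∈)
    with ∈-resp-↭ pa w∈
  ... | here w≡v = w≢v w≡v
  ... | there (here refl)
    with d , rs , pw , dd , rs≤1 ← 2≤twos⇒N↭ le (N-sym a∈S w∈)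
    with b∈ ← ∈-resp-↭ (↭-sym pv) (there (here refl))
       | c∈ ← ∈-resp-↭ (↭-sym pv) (there (there (here refl)))
       | d∈ ← ∈-resp-↭ (↭-sym pw) (there (here refl))
    with b′ , pb ← deg2⇒N↭ (c3⇒twos v∈S kv b∈) (N-sym v∈S b∈)
       | c′ , pc ← deg2⇒N↭ (c3⇒twos v∈S kv c∈) (N-sym v∈S c∈)
       | d′ , pd ← deg2⇒N↭ dd (N-sym w∈S d∈) =
    irreducible class3NearClass2 class3NearClass2-sound (record
      { h = lookup (v ∷ a ∷ b ∷ c ∷ w ∷ d ∷ [])
      ; h∈S = λ { 0F → v∈S ; 1F → a∈S ; 2F → N⊆S b∈ ; 3F → N⊆S c∈ ; 4F → w∈S ; 5F → N⊆S d∈ }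
      ; out = lookup ([] ∷ [] ∷ (b′ ∷ []) ∷ (c′ ∷ []) ∷ rs ∷ (d′ ∷ []) ∷ [])
      ; N↭ = λ { 0F → pv ; 1F → pa ; 2F → pb ; 3F → pc ; 4F → pw ; 5F → pd }
      ; length-out = λ { 0F → z≤n ; 1F → z≤n ; 2F → ℕ.≤-refl ; 3F → ℕ.≤-refl ; 4F → rs≤1 ; 5F → ℕ.≤-refl }
      ; exempt-ok = [] })

  c2⇒deg≢2 : ∀ {v} → kind v ≡ c2 → deg v ≢ 2
  c2⇒deg≢2 k d with () ← trans (sym k) (deg⇒kind≡two d)

  c1⇒deg≢2 : ∀ {v} → kind v ≡ c1 → deg v ≢ 2
  c1⇒deg≢2 k d with () ← trans (sym k) (deg⇒kind≡two d)

  no-c2-c2 : ∀ {u v} → lookup S u ≡ true → v ∈ N u → kind u ≡ c2 → kind v ≢ c2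
  no-c2-c2 {u} {v} u∈S v∈ ku kv
    with v∈S ← N⊆S v∈
    with a , b , pu , da , db ← c2⇒N↭ u∈S ku v∈ (c2⇒deg≢2 kv)
       | c , d , pv , dc , dd ← c2⇒N↭ v∈S kv (N-sym u∈S v∈) (c2⇒deg≢2 ku)
    with a∈ ← ∈-resp-↭ (↭-sym pu) (here refl) | b∈ ← ∈-resp-↭ (↭-sym pu) (there (here refl))
       | c∈ ← ∈-resp-↭ (↭-sym pv) (here refl) | d∈ ← ∈-resp-↭ (↭-sym pv) (there (here refl))
    with a′ , pa ← deg2⇒N↭ da (N-sym u∈S a∈) | b′ , pb ← deg2⇒N↭ db (N-sym u∈S b∈)
       | c′ , pc ← deg2⇒N↭ dc (N-sym v∈S c∈) | d′ , pd ← deg2⇒N↭ dd (N-sym v∈S d∈) =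
    irreducible class2Class2 class2Class2-sound (record
      { h = lookup (u ∷ v ∷ a ∷ b ∷ c ∷ d ∷ [])
      ; h∈S = λ { 0F → u∈S ; 1F → v∈S ; 2F → N⊆S a∈ ; 3F → N⊆S b∈ ; 4F → N⊆S c∈ ; 5F → N⊆S d∈ }
      ; out = lookup ([] ∷ [] ∷ (a′ ∷ []) ∷ (b′ ∷ []) ∷ (c′ ∷ []) ∷ (d′ ∷ []) ∷ [])
      ; N↭ = λ { 0F → pu ; 1F → pv ; 2F → pa ; 3F → pb ; 4F → pc ; 5F → pd }
      ; length-out = λ { 0F → z≤n ; 1F → z≤n ; 2F → ℕ.≤-refl ; 3F → ℕ.≤-refl ; 4F → ℕ.≤-refl ; 5F → ℕ.≤-refl }
      ; exempt-ok = [] })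

  no-c2-c1-c2 : ∀ {w p u v} → lookup S w ≡ true → N w ↭ p ∷ u ∷ v ∷ [] → kind w ≡ c1 → deg p ≡ 2 →
    kind u ≡ c2 → kind v ≢ c2
  no-c2-c1-c2 {w} {p} {u} {v} w∈S pw kw dp ku kv
    with p∈ ← ∈-resp-↭ (↭-sym pw) (here refl)
       | u∈ ← ∈-resp-↭ (↭-sym pw) (there (here refl))
       | v∈ ← ∈-resp-↭ (↭-sym pw) (there (there (here refl)))
    with u∈S ← N⊆S u∈ | v∈S ← N⊆S v∈
    with p′ , pp ← deg2⇒N↭ dp (N-sym w∈S p∈)
       | a , b , pu , da , db ← c2⇒N↭ u∈S ku (N-sym w∈S u∈) (c1⇒deg≢2 kw)
       | c , d , pv , dc , dd ← c2⇒N↭ v∈S kv (N-sym w∈S v∈) (c1⇒deg≢2 kw)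
    with a∈ ← ∈-resp-↭ (↭-sym pu) (here refl) | b∈ ← ∈-resp-↭ (↭-sym pu) (there (here refl))
       | c∈ ← ∈-resp-↭ (↭-sym pv) (here refl) | d∈ ← ∈-resp-↭ (↭-sym pv) (there (here refl))
    with a′ , pa ← deg2⇒N↭ da (N-sym u∈S a∈) | b′ , pb ← deg2⇒N↭ db (N-sym u∈S b∈)
       | c′ , pc ← deg2⇒N↭ dc (N-sym v∈S c∈) | d′ , pd ← deg2⇒N↭ dd (N-sym v∈S d∈) =
    irreducible class2Class1Class2 class2Class1Class2-sound (record
      { h = lookup (w ∷ p ∷ u ∷ v ∷ a ∷ b ∷ c ∷ d ∷ [])
      ; h∈S = λ { 0F → w∈S ; 1F → N⊆S p∈ ; 2F → u∈S ; 3F → v∈S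
                ; 4F → N⊆S a∈ ; 5F → N⊆S b∈ ; 6F → N⊆S c∈ ; 7F → N⊆S d∈ }
      ; out = lookup ([] ∷ (p′ ∷ []) ∷ [] ∷ [] ∷ (a′ ∷ []) ∷ (b′ ∷ []) ∷ (c′ ∷ []) ∷ (d′ ∷ []) ∷ [])
      ; N↭ = λ { 0F → pw ; 1F → pp ; 2F → pu ; 3F → pv ; 4F → pa ; 5F → pb ; 6F → pc ; 7F → pd }
      ; length-out = λ { 0F → z≤n ; 1F → ℕ.≤-refl ; 2F → z≤n ; 3F → z≤n
                       ; 4F → ℕ.≤-refl ; 5F → ℕ.≤-refl ; 6F → ℕ.≤-refl ; 7F → ℕ.≤-refl }
      ; exempt-ok = [] })

  -- A common neighbour of x and y other than v would have class at least 2.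
  c3-two-notSQ : ∀ {v x y} → lookup S v ≡ true → kind v ≡ c3 → x ∈ N v → deg y ≡ 2 → y ∉ N v → ¬ SQ x y
  c3-two-notSQ v∈S kv x∈ dy y∉ (x≢y , inj₁ y∈) = no-twoTwo (N⊆S x∈) y∈ (c3⇒twos v∈S kv x∈) dy
  c3-two-notSQ {v} v∈S kv x∈ dy y∉ (x≢y , inj₂ (m , m∈ , y∈)) with m Fin.≟ v
  ... | yes refl = y∉ y∈
  ... | no m≢v   = c3-two-2≤twos v∈S kv x∈ m∈ m≢v
    (distinct⇒2≤length (twos⁺ (N-sym (N⊆S x∈) m∈) (c3⇒twos v∈S kv x∈)) (twos⁺ y∈ dy) x≢y)

  -- Here w would owe 3 to p and 1 to u, with no class 0 neighbour to cover the deficit. The tree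
  -- has pairs at distance 5; each consists of a 2-neighbour of v and another 2-vertex, so
  -- `c3-two-notSQ` applies.
  no-c3-two-c1-c2-c1 : ∀ {v p w u z} → lookup S v ≡ true → kind v ≡ c3 → p ∈ N v → w ∈ N p → w ≢ v →
    N w ↭ p ∷ u ∷ z ∷ [] → kind w ≡ c1 → kind u ≡ c2 → kind z ≢ c1
  no-c3-two-c1-c2-c1 {v} {p} {w} {u} {z} v∈S kv p∈ w∈ w≢v pw kw ku kz
    with b , c , pv ← c3⇒N↭ v∈S kv p∈
    with dp ← c3⇒twos v∈S kv p∈
    with p∈S ← N⊆S p∈ | w∈S ← N⊆S w∈
    with w′ , pp ← deg2⇒N↭ dp (N-sym v∈S p∈)
    with ∈-resp-↭ pp w∈
  ... | here w≡v = w≢v w≡v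
  ... | there (here refl)
    with b∈ ← ∈-resp-↭ (↭-sym pv) (there (here refl))
       | c∈ ← ∈-resp-↭ (↭-sym pv) (there (there (here refl)))
       | u∈ ← ∈-resp-↭ (↭-sym pw) (there (here refl))
       | z∈ ← ∈-resp-↭ (↭-sym pw) (there (there (here refl)))
    with u∈S ← N⊆S u∈ | z∈S ← N⊆S z∈
    with b′ , pb ← deg2⇒N↭ (c3⇒twos v∈S kv b∈) (N-sym v∈S b∈)
       | c′ , pc ← deg2⇒N↭ (c3⇒twos v∈S kv c∈) (N-sym v∈S c∈)
       | d , e , pu , dd , de ← c2⇒N↭ u∈S ku (N-sym w∈S u∈) (c1⇒deg≢2 kw)
       | q , z′ , pz , dq ← c1⇒N↭ z∈S kz (N-sym w∈S z∈) (c1⇒deg≢2 kw)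
    with d∈ ← ∈-resp-↭ (↭-sym pu) (here refl) | e∈ ← ∈-resp-↭ (↭-sym pu) (there (here refl))
       | q∈ ← ∈-resp-↭ (↭-sym pz) (there (here refl))
    with d′ , pd ← deg2⇒N↭ dd (N-sym u∈S d∈) | e′ , pe ← deg2⇒N↭ de (N-sym u∈S e∈)
       | q′ , pq ← deg2⇒N↭ dq (N-sym z∈S q∈) =
    irreducible class3NearBusyClass1 class3NearBusyClass1-sound (record
      { h = lookup (v ∷ p ∷ b ∷ c ∷ w ∷ u ∷ d ∷ e ∷ z ∷ q ∷ [])
      ; h∈S = λ { 0F → v∈S ; 1F → p∈S ; 2F → N⊆S b∈ ; 3F → N⊆S c∈ ; 4F → w∈S
                ; 5F → u∈S ; 6F → N⊆S d∈ ; 7F → N⊆S e∈ ; 8F → z∈S ; 9F → N⊆S q∈ }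
      ; out = lookup ([] ∷ [] ∷ (b′ ∷ []) ∷ (c′ ∷ []) ∷ [] ∷ [] ∷ (d′ ∷ []) ∷ (e′ ∷ [])
                      ∷ (z′ ∷ []) ∷ (q′ ∷ []) ∷ [])
      ; N↭ = λ { 0F → pv ; 1F → pp ; 2F → pb ; 3F → pc ; 4F → pw
               ; 5F → pu ; 6F → pd ; 7F → pe ; 8F → pz ; 9F → pq }
      ; length-out = λ { 0F → z≤n ; 1F → z≤n ; 2F → ℕ.≤-refl ; 3F → ℕ.≤-refl ; 4F → z≤n
                       ; 5F → z≤n ; 6F → ℕ.≤-refl ; 7F → ℕ.≤-refl ; 8F → ℕ.≤-refl ; 9F → ℕ.≤-refl }
      ; exempt-ok = notSQ b∈ dd d∉ ∷ notSQ b∈ de e∉ ∷ notSQ b∈ dq q∉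
                  ∷ notSQ c∈ dd d∉ ∷ notSQ c∈ de e∉ ∷ notSQ c∈ dq q∉ ∷ []
      })
    where
    notSQ : ∀ {x y} → x ∈ N v → deg y ≡ 2 → y ∉ N v → ¬ SQ x y
    notSQ = c3-two-notSQ v∈S kv

    -- An edge from y to v would close v p w t y to a 5-cycle. Backtracking is excluded by degrees:
    -- p and y have degree 2, t and w do not.
    beyond : ∀ {t y} → t ∈ N w → deg t ≢ 2 → y ∈ N t → deg y ≡ 2 → y ∉ N v
    beyond t∈ dt y∈ dy y∈v = notAdjacent (s≤s (s≤s z≤n)) (proj₂ (∈N⁻ p∈))
      (step (proj₂ (∈N⁻ w∈)) w≢v
        (step (proj₂ (∈N⁻ t∈)) (λ { refl → dt dp })
          (step (proj₂ (∈N⁻ y∈)) (λ { refl → c1⇒deg≢2 kw dy }) stop)))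
      (adj-sym (proj₂ (∈N⁻ y∈v)))

    d∉ : d ∉ N v
    d∉ = beyond u∈ (c2⇒deg≢2 ku) d∈ dd

    e∉ : e ∉ N v
    e∉ = beyond u∈ (c2⇒deg≢2 ku) e∈ de

    q∉ : q ∉ N v
    q∉ = beyond z∈ (c1⇒deg≢2 kz) q∈ dq

  -- Final charges

  c3-neighbour? : ∀ v → Dec (Any (λ u → kind u ≡ c3) (N v))
  c3-neighbour? v = Any.any? (λ u → kind u ≟c3) (N v)

  sends : Fin n → Fin n → ℕ
  sends u v = give (kind u) (kind v) ⌊ c3-neighbour? v ⌋

  -- The final charge, 7 deg - 18 plus received minus sent, is nonnegative; the terms are rearranged
  -- to avoid truncated subtraction. The list is a parameter so that neighbours can be put in a
  -- convenient order.
  Balanced : Fin n → List (Fin n) → Set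
  Balanced v us = 18 + sum (map (sends v) us) ≤ 7 * length us + sum (map (λ u → sends u v) us)

  Balanced-↭ : ∀ {v us} → N v ↭ us → Balanced v us → Balanced v (N v)
  Balanced-↭ {v} p = subst₂ _≤_
    (cong (18 +_) (sym (sum-↭ (↭-map⁺ (sends v) p))))
    (sym (cong₂ (λ l m → 7 * l + m) (↭-length p) (sum-↭ (↭-map⁺ (λ u → sends u v) p))))

  deg≢2⇒kind≢two : ∀ {v} → deg v ≢ 2 → kind v ≢ two
  deg≢2⇒kind≢two {v} d k = d (kind≡two⇒deg {v} k)

  -- The 3 is the initial charge 7 * 3 - 18.
  balanced₃ : ∀ {v x y z} a b c → N v ↭ x ∷ y ∷ z ∷ [] →
    sends v x ≤ a → sends v y ≤ b → sends v z ≤ c →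
    a + b + c ≤ 3 + (sends x v + (sends y v + sends z v)) → Balanced v (N v)
  balanced₃ {v} {x} {y} {z} a b c p ≤a ≤b ≤c le = Balanced-↭ p (begin
    18 + (sends v x + (sends v y + (sends v z + 0)))
      ≡⟨ cong (λ m → 18 + (sends v x + (sends v y + m))) (ℕ.+-identityʳ _) ⟩
    18 + (sends v x + (sends v y + sends v z))
      ≡⟨ cong (18 +_) (ℕ.+-assoc (sends v x) _ _) ⟨
    18 + (sends v x + sends v y + sends v z)
      ≤⟨ ℕ.+-monoʳ-≤ 18 (ℕ.+-mono-≤ (ℕ.+-mono-≤ ≤a ≤b) ≤c) ⟩
    18 + (a + b + c)
      ≤⟨ ℕ.+-monoʳ-≤ 18 le ⟩
    21 + (sends x v + (sends y v + sends z v))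
      ≡⟨ cong (λ m → 21 + (sends x v + (sends y v + m))) (ℕ.+-identityʳ _) ⟨
    21 + (sends x v + (sends y v + (sends z v + 0))) ∎)
    where open ℕ.≤-Reasoning

  flag : ∀ {v u} → u ∈ N v → kind u ≡ c3 → ⌊ c3-neighbour? v ⌋ ≡ true
  flag {v} u∈ k with c3-neighbour? v
  ... | yes _  = refl
  ... | no  ¬a = contradiction (lose u∈ k) ¬a

  two-balanced : ∀ {v x y} → lookup S v ≡ true → kind v ≡ two → N v ↭ x ∷ y ∷ [] →
    deg x ≢ 2 → deg y ≢ 2 → Balanced v (N v)
  two-balanced {v} {x} {y} v∈S kv p dx dy = Balanced-↭ p (begin
    18 + (sends v x + (sends v y + 0)) ≤⟨ ℕ.+-monoʳ-≤ 18 (ℕ.+-mono-≤ (give-from-two (kind x) _ kv)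
                                            (ℕ.+-monoˡ-≤ 0 (give-from-two (kind y) _ kv))) ⟩
    18                                 ≤⟨ ℕ.+-monoʳ-≤ 14 receives ⟩
    14 + (sends x v + sends y v)       ≡⟨ cong (λ m → 14 + (sends x v + m)) (ℕ.+-identityʳ _) ⟨
    14 + (sends x v + (sends y v + 0)) ∎)
    where
    open ℕ.≤-Reasoning
    x∈ : x ∈ N v
    x∈ = ∈-resp-↭ (↭-sym p) (here refl)

    y∈ : y ∈ N v
    y∈ = ∈-resp-↭ (↭-sym p) (there (here refl))

    x≢y : Unique (x ∷ y ∷ []) → x ≢ y
    x≢y ((ne ∷ _) ∷ _) = ne

    -- The deficit 18 - 7 * 2 = 4 is met by 2 + 2 or by 1 + 3.
    receives : 4 ≤ sends x v + sends y v
    receives with kind x ≟c3 | kind y ≟c3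
    ... | no kx  | no ky  = ℕ.+-mono-≤ (give-to-two _ (deg≢2⇒kind≢two dx) kx kv)
                                       (give-to-two _ (deg≢2⇒kind≢two dy) ky kv)
    ... | yes kx | no ky  = ℕ.+-mono-≤ (ℕ.≤-reflexive (sym (give-c3-two _ kx kv)))
                                       (give-to-flagged-two (deg≢2⇒kind≢two dy) ky kv (flag x∈ kx))
    ... | no kx  | yes ky = ℕ.+-mono-≤ (give-to-flagged-two (deg≢2⇒kind≢two dx) kx kv (flag y∈ ky))
                                       (ℕ.≤-reflexive (sym (give-c3-two _ ky kv)))
    ... | yes kx | yes ky = ⊥-elim (c3-two-2≤twos (N⊆S x∈) kx (N-sym v∈S x∈) y∈
      (x≢y (Permutation.Unique-resp-↭ (setoid (Fin n)) (↭⇒↭ₛ p) (N-unique v)) ∘ sym)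
      (c3⇒2≤twos (N⊆S y∈) ky))

  kind≢c3 : ∀ {u v} → lookup S v ≡ true → u ∈ N v → deg v ≢ 2 → kind u ≢ c3
  kind≢c3 v∈S u∈ dv k = dv (c3⇒twos (N⊆S u∈) k (N-sym v∈S u∈))

  -- The vertex pays 2 + 2 out of 3, and z, necessarily of class 0 or 1, supplies the missing 1.
  -- Neither 2-neighbour is flagged, as it would lie between classes 2 and 3.
  c2-balanced : ∀ {v x y z} → lookup S v ≡ true → kind v ≡ c2 → N v ↭ x ∷ y ∷ z ∷ [] →
    deg x ≡ 2 → deg y ≡ 2 → deg z ≢ 2 → Balanced v (N v)
  c2-balanced {v} {x} {y} {z} v∈S kv p dx dy dz = balanced₃ 2 2 0 p
    (to-two (∈-resp-↭ (↭-sym p) (here refl)) dx)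
    (to-two (∈-resp-↭ (↭-sym p) (there (here refl))) dy)
    (give-from-c2 {l = kind z} _ kv (deg≢2⇒kind≢two dz))
    (ℕ.+-monoʳ-≤ 3 (ℕ.≤-trans (give-to-c2 _ (kz (kind z) refl) kv)
      (ℕ.≤-trans (ℕ.m≤n+m _ (sends y v)) (ℕ.m≤n+m _ (sends x v)))))
    where
    to-two : ∀ {u} → u ∈ N v → deg u ≡ 2 → sends v u ≤ 2
    to-two {u} u∈ du with c3-neighbour? u
    ... | no _  = give-unflagged-two≤2 (kind v) (deg⇒kind≡two du) refl
    ... | yes a with t , t∈ , kt ← find a =
      ⊥-elim (c3-two-2≤twos t∈S kt (N-sym (N⊆S u∈) t∈) (N-sym v∈S u∈) v≢t (c2⇒2≤twos v∈S kv))
      where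
      t∈S = N⊆S t∈
      v≢t : v ≢ t
      v≢t refl with () ← trans (sym kv) kt

    z∈ : z ∈ N v
    z∈ = ∈-resp-↭ (↭-sym p) (there (there (here refl)))

    kz : ∀ k → kind z ≡ k → kind z ≡ c0 ⊎ kind z ≡ c1
    kz two e = contradiction e (deg≢2⇒kind≢two dz)
    kz c0  e = inj₁ e
    kz c1  e = inj₂ e
    kz c2  e = contradiction e (no-c2-c2 v∈S z∈ kv)
    kz c3  e = contradiction e (kind≢c3 v∈S z∈ (c2⇒deg≢2 kv))

  -- If x is unflagged, v pays 2 + 1 out of 3. If x is flagged, v pays 3 + 1, but then z can only be
  -- of class 0, and its gift of 1 closes the gap.
  c1-c2-balanced : ∀ {v x y z} → lookup S v ≡ true → kind v ≡ c1 → N v ↭ x ∷ y ∷ z ∷ [] →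
    deg x ≡ 2 → deg z ≢ 2 → kind y ≡ c2 → Balanced v (N v)
  c1-c2-balanced {v} {x} {y} {z} v∈S kv p dx dz ky with c3-neighbour? x in flagged
  ... | no _ = balanced₃ 2 1 0 p
    (give-unflagged-two≤2 (kind v) (deg⇒kind≡two dx) (cong ⌊_⌋ flagged))
    (ℕ.≤-reflexive (give-c1-c2 _ kv ky))
    (give-from-c1 _ kv (deg≢2⇒kind≢two dz) (no-c2-c1-c2 v∈S p kv dx ky))
    (ℕ.m≤m+n 3 _)
  ... | yes a = balanced₃ 3 1 0 p
    (give-two≤3 (kind v) _ (deg⇒kind≡two dx))
    (ℕ.≤-reflexive (give-c1-c2 _ kv ky))
    (give-from-c1 _ kv (deg≢2⇒kind≢two dz) (no-c2-c1-c2 v∈S p kv dx ky))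
    (ℕ.+-monoʳ-≤ 3 (ℕ.≤-trans (give-c0-c1 _ (kz (kind z) refl) kv)
      (ℕ.≤-trans (ℕ.m≤n+m _ (sends y v)) (ℕ.m≤n+m _ (sends x v)))))
    where
    x∈ : x ∈ N v
    x∈ = ∈-resp-↭ (↭-sym p) (here refl)

    z∈ : z ∈ N v
    z∈ = ∈-resp-↭ (↭-sym p) (there (there (here refl)))

    kz≢c1 : kind z ≢ c1
    kz≢c1 with t , t∈ , kt ← find a =
      no-c3-two-c1-c2-c1 (N⊆S t∈) kt (N-sym (N⊆S x∈) t∈) (N-sym v∈S x∈) (v≢t kt) p kv ky
      where
      v≢t : ∀ {t} → kind t ≡ c3 → v ≢ t
      v≢t kt refl with () ← trans (sym kv) kt

    kz : ∀ k → kind z ≡ k → kind z ≡ c0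
    kz two e = contradiction e (deg≢2⇒kind≢two dz)
    kz c0  e = e
    kz c1  e = contradiction e kz≢c1
    kz c2  e = contradiction e (no-c2-c1-c2 v∈S p kv dx ky)
    kz c3  e = contradiction e (kind≢c3 v∈S z∈ (c1⇒deg≢2 kv))

  c1-balanced : ∀ {v x y z} → lookup S v ≡ true → kind v ≡ c1 → N v ↭ x ∷ y ∷ z ∷ [] →
    deg x ≡ 2 → deg y ≢ 2 → deg z ≢ 2 → Balanced v (N v)
  c1-balanced {v} {x} {y} {z} v∈S kv p dx dy dz with kind y ≟c2 | kind z ≟c2
  ... | yes ky | _      = c1-c2-balanced v∈S kv p dx dz ky
  ... | no  _  | yes kz = c1-c2-balanced v∈S kv (↭-trans p (↭-prep x (↭-swap y z ↭-refl))) dx dy kz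
  ... | no  ky | no kz  = balanced₃ 3 0 0 p
    (give-two≤3 (kind v) _ (deg⇒kind≡two dx))
    (give-from-c1 _ kv (deg≢2⇒kind≢two dy) ky)
    (give-from-c1 _ kv (deg≢2⇒kind≢two dz) kz)
    (ℕ.m≤m+n 3 _)

  balanced : ∀ {v} → lookup S v ≡ true → Balanced v (N v)
  balanced {v} v∈S = go (kind v) refl (view v∈S)
    where
    go : ∀ k → kind v ≡ k → View v k → Balanced v (N v)
    go two kv (two p dx dy)    = two-balanced v∈S kv p dx dy
    go c0  kv (c0 p dx dy dz)  = balanced₃ 1 1 1 p
      (give-from-c0 _ kv (deg≢2⇒kind≢two dx))
      (give-from-c0 _ kv (deg≢2⇒kind≢two dy))
      (give-from-c0 _ kv (deg≢2⇒kind≢two dz))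
      (ℕ.m≤m+n 3 _)
    go c1  kv (c1 p dx dy dz)  = c1-balanced v∈S kv p dx dy dz
    go c2  kv (c2 p dx dy dz)  = c2-balanced v∈S kv p dx dy dz
    go c3  kv (c3 p dx dy dz)  = balanced₃ 1 1 1 p
      (ℕ.≤-reflexive (give-c3-two _ kv (deg⇒kind≡two dx)))
      (ℕ.≤-reflexive (give-c3-two _ kv (deg⇒kind≡two dy)))
      (ℕ.≤-reflexive (give-c3-two _ kv (deg⇒kind≡two dz)))
      (ℕ.m≤m+n 3 _)

-- Double counting

∑ : ∀ {A : Set} → List A → (A → ℕ) → ℕ
∑ xs f = sum (map f xs)

∑-cong : ∀ {A : Set} (xs : List A) {f g : A → ℕ} → (∀ x → f x ≡ g x) → ∑ xs f ≡ ∑ xs g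
∑-cong xs eq = cong sum (map-cong eq xs)

∑-mono : ∀ {A : Set} (xs : List A) {f g : A → ℕ} → (∀ {x} → x ∈ xs → f x ≤ g x) → ∑ xs f ≤ ∑ xs g
∑-mono []       le = z≤n
∑-mono (x ∷ xs) le = ℕ.+-mono-≤ (le (here refl)) (∑-mono xs (le ∘ there))

∑-zero : ∀ {A : Set} (xs : List A) → ∑ xs (λ _ → 0) ≡ 0
∑-zero []       = refl
∑-zero (x ∷ xs) = ∑-zero xs

∑-+ : ∀ {A : Set} (xs : List A) (f g : A → ℕ) → ∑ xs (λ x → f x + g x) ≡ ∑ xs f + ∑ xs g
∑-+ []       f g = refl
∑-+ (x ∷ xs) f g = begin
  f x + g x + ∑ xs (λ x → f x + g x)  ≡⟨ cong (f x + g x +_) (∑-+ xs f g) ⟩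
  f x + g x + (∑ xs f + ∑ xs g)       ≡⟨ ℕ.+-assoc (f x) (g x) _ ⟩
  f x + (g x + (∑ xs f + ∑ xs g))     ≡⟨ cong (f x +_) (ℕ.+-assoc (g x) _ _) ⟨
  f x + (g x + ∑ xs f + ∑ xs g)       ≡⟨ cong (λ m → f x + (m + ∑ xs g)) (ℕ.+-comm (g x) _) ⟩
  f x + (∑ xs f + g x + ∑ xs g)       ≡⟨ cong (f x +_) (ℕ.+-assoc (∑ xs f) (g x) _) ⟩
  f x + (∑ xs f + (g x + ∑ xs g))     ≡⟨ ℕ.+-assoc (f x) _ _ ⟨
  f x + ∑ xs f + (g x + ∑ xs g)       ∎
  where open ≡-Reasoning

∑-* : ∀ {A : Set} (xs : List A) m (f : A → ℕ) → ∑ xs (λ x → m * f x) ≡ m * ∑ xs f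
∑-* []       m f = sym (ℕ.*-zeroʳ m)
∑-* (x ∷ xs) m f = trans (cong (m * f x +_) (∑-* xs m f)) (sym (ℕ.*-distribˡ-+ m (f x) (∑ xs f)))

∑-swap : ∀ {A B : Set} (xs : List A) (ys : List B) (f : A → B → ℕ) →
  ∑ xs (λ x → ∑ ys (f x)) ≡ ∑ ys (λ y → ∑ xs (λ x → f x y))
∑-swap []       ys f = sym (∑-zero ys)
∑-swap (x ∷ xs) ys f = trans (cong (∑ ys (f x) +_) (∑-swap xs ys f))
  (sym (∑-+ ys (f x) (λ y → ∑ xs (λ x → f x y))))

∑-filter : ∀ {A : Set} (b : A → Bool) (xs : List A) (f : A → ℕ) →
  ∑ (filter (λ x → b x Bool.≟ true) xs) f ≡ ∑ xs (λ x → b2n (b x) * f x)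
∑-filter b []       f = refl
∑-filter b (x ∷ xs) f with b x
... | true  = cong₂ _+_ (sym (ℕ.*-identityˡ (f x))) (∑-filter b xs f)
... | false = ∑-filter b xs f

∑-one : ∀ {A : Set} (xs : List A) → ∑ xs (λ _ → 1) ≡ length xs
∑-one []       = refl
∑-one (x ∷ xs) = cong suc (∑-one xs)

∑-lookup : ∀ {n} (S : Subset n) → ∑ (allFin n) (λ v → b2n (lookup S v)) ≡ ∣ S ∣
∑-lookup S = trans (cong sum (map-tabulate id (λ v → b2n (lookup S v)))) (go S)
  where
  go : ∀ {n} (S : Subset n) → sum (List.tabulate (λ v → b2n (lookup S v))) ≡ ∣ S ∣
  go []          = refl
  go (true ∷ S)  = cong suc (go S)
  go (false ∷ S) = go S

b2n-∧ : ∀ a b → b2n (a ∧ b) ≡ b2n a * b2n b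
b2n-∧ true  b = sym (ℕ.+-identityʳ (b2n b))
b2n-∧ false b = refl

module Counting {n : ℕ} (G : Graph n) (S : Subset n) where

  open Neighbours G S

  members : List (Fin n)
  members = filter (λ v → lookup S v Bool.≟ true) (allFin n)

  members⁻ : ∀ {v} → v ∈ members → lookup S v ≡ true
  members⁻ v∈ = proj₂ (∈-filter⁻ (λ v → lookup S v Bool.≟ true) {xs = allFin n} v∈)

  arc : Fin n → Fin n → ℕ
  arc u v = b2n (inS S u ∧ inS S v ∧ adj G u v)

  arc-sym : ∀ u v → arc u v ≡ arc v u
  arc-sym u v rewrite symmetric G u v with lookup S u | lookup S v
  ... | true  | true  = refl
  ... | true  | false = refl
  ... | false | true  = refl
  ... | false | false = refl

  -- Passes to full double sums with the symmetric 0/1 weight `arc`, where the order of summation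
  -- can be exchanged.
  ∑-N : ∀ (f : Fin n → Fin n → ℕ) →
    ∑ members (λ v → ∑ (N v) (f v)) ≡ ∑ (allFin n) (λ v → ∑ (allFin n) (λ u → arc v u * f v u))
  ∑-N f = trans (∑-filter (lookup S) (allFin n) (λ v → ∑ (N v) (f v))) (∑-cong (allFin n) inner)
    where
    open ≡-Reasoning
    inner : ∀ v → b2n (lookup S v) * ∑ (N v) (f v) ≡ ∑ (allFin n) (λ u → arc v u * f v u)
    inner v = begin
      b2n (lookup S v) * ∑ (N v) (f v)
        ≡⟨ cong (b2n (lookup S v) *_) (∑-filter (λ u → lookup S u ∧ adj G v u) (allFin n) (f v)) ⟩
      b2n (lookup S v) * ∑ (allFin n) (λ u → b2n (lookup S u ∧ adj G v u) * f v u)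
        ≡⟨ ∑-* (allFin n) (b2n (lookup S v)) _ ⟨
      ∑ (allFin n) (λ u → b2n (lookup S v) * (b2n (lookup S u ∧ adj G v u) * f v u))
        ≡⟨ ∑-cong (allFin n) (λ u → trans
             (sym (ℕ.*-assoc (b2n (lookup S v)) (b2n (lookup S u ∧ adj G v u)) (f v u)))
             (cong (_* f v u) (sym (b2n-∧ (lookup S v) (lookup S u ∧ adj G v u))))) ⟩
      ∑ (allFin n) (λ u → arc v u * f v u) ∎

  ∑-N-flip : ∀ (f : Fin n → Fin n → ℕ) →
    ∑ members (λ v → ∑ (N v) (f v)) ≡ ∑ members (λ v → ∑ (N v) (λ u → f u v))
  ∑-N-flip f = begin
    ∑ members (λ v → ∑ (N v) (f v))                                  ≡⟨ ∑-N f ⟩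
    ∑ (allFin n) (λ v → ∑ (allFin n) (λ u → arc v u * f v u))        ≡⟨ ∑-swap (allFin n) (allFin n) _ ⟩
    ∑ (allFin n) (λ u → ∑ (allFin n) (λ v → arc v u * f v u))
      ≡⟨ ∑-cong (allFin n) (λ u → ∑-cong (allFin n) (λ v → cong (_* f v u) (arc-sym v u))) ⟩
    ∑ (allFin n) (λ u → ∑ (allFin n) (λ v → arc u v * f v u))        ≡⟨ ∑-N (flip f) ⟨
    ∑ members (λ v → ∑ (N v) (λ u → f u v))                          ∎
    where open ≡-Reasoning

  orderedArc : Fin n → Fin n → ℕ
  orderedArc u v = b2n (⌊ toℕ u ℕ.<? toℕ v ⌋ ∧ inS S u ∧ inS S v ∧ adj G u v)

  arc-ordered : ∀ u v → arc u v ≡ orderedArc u v + orderedArc v u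
  arc-ordered u v with toℕ u ℕ.<? toℕ v | toℕ v ℕ.<? toℕ u
  ... | yes u<v | yes v<u = contradiction v<u (ℕ.<-asym u<v)
  ... | yes _   | no _    = sym (ℕ.+-identityʳ (arc u v))
  ... | no _    | yes _   = arc-sym u v
  -- Here u = v, and both sides vanish because there are no loops.
  ... | no u≮v  | no v≮u  with refl ← Fin.toℕ-injective (ℕ.≤-antisym (ℕ.≮⇒≥ v≮u) (ℕ.≮⇒≥ u≮v))
                          rewrite irrefl G u with lookup S u
  ... | true  = refl
  ... | false = refl

  ∑-deg : ∑ members (λ v → length (N v)) ≡ 2 * inducedEdges G S
  ∑-deg = begin
    ∑ members (λ v → length (N v))
      ≡⟨ ∑-cong members (λ v → sym (∑-one (N v))) ⟩
    ∑ members (λ v → ∑ (N v) (λ _ → 1))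
      ≡⟨ ∑-N (λ _ _ → 1) ⟩
    ∑ V (λ u → ∑ V (λ v → arc u v * 1))
      ≡⟨ ∑-cong V (λ u → ∑-cong V (λ v → trans (ℕ.*-identityʳ _) (arc-ordered u v))) ⟩
    ∑ V (λ u → ∑ V (λ v → orderedArc u v + orderedArc v u))
      ≡⟨ ∑-cong V (λ u → ∑-+ V (orderedArc u) (λ v → orderedArc v u)) ⟩
    ∑ V (λ u → ∑ V (orderedArc u) + ∑ V (λ v → orderedArc v u))
      ≡⟨ ∑-+ V (λ u → ∑ V (orderedArc u)) (λ u → ∑ V (λ v → orderedArc v u)) ⟩
    inducedEdges G S + ∑ V (λ u → ∑ V (λ v → orderedArc v u))
      ≡⟨ cong (inducedEdges G S +_) (∑-swap V V (λ u v → orderedArc v u)) ⟩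
    inducedEdges G S + inducedEdges G S
      ≡⟨ cong (inducedEdges G S +_) (ℕ.+-identityʳ _) ⟨
    2 * inducedEdges G S ∎
    where
    open ≡-Reasoning
    V = allFin n

  ∑-members-one : ∑ members (λ _ → 1) ≡ ∣ S ∣
  ∑-members-one = trans (∑-filter (lookup S) (allFin n) (λ _ → 1))
    (trans (∑-cong (allFin n) (λ v → ℕ.*-identityʳ _)) (∑-lookup S))

  -- Each gift is sent once and received once, so the totals cancel by `∑-N-flip`; what remains is
  -- the negation of the mad bound for `S`.
  dense : (sends : Fin n → Fin n → ℕ) →
    (∀ {v} → lookup S v ≡ true → 18 + ∑ (N v) (sends v) ≤ 7 * length (N v) + ∑ (N v) (λ u → sends u v)) →
    18 * ∣ S ∣ ≤ 7 * (2 * inducedEdges G S)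
  dense sends balanced = ℕ.+-cancelʳ-≤ (∑ members (λ v → ∑ (N v) (sends v))) _ _ (begin
    18 * ∣ S ∣ + ∑ members (λ v → ∑ (N v) (sends v))
      ≡⟨ cong (λ m → 18 * m + ∑ members (λ v → ∑ (N v) (sends v))) ∑-members-one ⟨
    18 * ∑ members (λ _ → 1) + ∑ members (λ v → ∑ (N v) (sends v))
      ≡⟨ cong (_+ ∑ members (λ v → ∑ (N v) (sends v))) (∑-* members 18 (λ _ → 1)) ⟨
    ∑ members (λ _ → 18) + ∑ members (λ v → ∑ (N v) (sends v))
      ≡⟨ ∑-+ members (λ _ → 18) (λ v → ∑ (N v) (sends v)) ⟨
    ∑ members (λ v → 18 + ∑ (N v) (sends v))
      ≤⟨ ∑-mono members (λ v∈ → balanced (members⁻ v∈)) ⟩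
    ∑ members (λ v → 7 * length (N v) + ∑ (N v) (λ u → sends u v))
      ≡⟨ ∑-+ members (λ v → 7 * length (N v)) (λ v → ∑ (N v) (λ u → sends u v)) ⟩
    ∑ members (λ v → 7 * length (N v)) + ∑ members (λ v → ∑ (N v) (λ u → sends u v))
      ≡⟨ cong₂ _+_ (trans (∑-* members 7 (λ v → length (N v))) (cong (7 *_) ∑-deg)) (sym (∑-N-flip sends)) ⟩
    7 * (2 * inducedEdges G S) + ∑ members (λ v → ∑ (N v) (sends v)) ∎)
    where open ℕ.≤-Reasoning

-- Deciding list colourings, and the induction

-- Removes the double negation left by the induction. A colouring is recorded by its positions in
-- the lists, a map `Fin n → Fin k`, and `funToFin` makes the search finite.
listColoring? : ∀ {n k} (A : Fin n → Fin n → Bool) (L : Fin n → List ℕ) → (∀ v → length (L v) ≡ k) →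
  Dec (Σ[ c ∈ (Fin n → ℕ) ] (∀ v → c v ∈ L v) × (∀ u v → A u v ≡ true → ¬ (c u ≡ c v)))
listColoring? {n} {k} A L len = map′ to from
  (Fin.any? (λ i → proper? (colour (Fin.finToFun i))))
  where
  Proper : (Fin n → ℕ) → Set
  Proper c = ∀ u v → A u v ≡ true → ¬ (c u ≡ c v)

  proper? : ∀ c → Dec (Proper c)
  proper? c = Fin.all? (λ u → Fin.all? (λ v → (A u v Bool.≟ true) →-dec ¬? (c u ℕ.≟ c v)))

  colour : (Fin n → Fin k) → Fin n → ℕ
  colour f v = List.lookup (L v) (Fin.cast (sym (len v)) (f v))

  to : ∃ (λ i → Proper (colour (Fin.finToFun i))) → _
  to (i , proper) = colour (Fin.finToFun i) , (λ v → ∈-lookup _) , proper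

  from : _ → ∃ (λ i → Proper (colour (Fin.finToFun i)))
  from (c , c∈L , proper) = Fin.funToFin index , λ u v e eq →
    proper u v e (trans (sym (colour-index u)) (trans eq (colour-index v)))
    where
    index : Fin n → Fin k
    index v = Fin.cast (len v) (Any.index (c∈L v))

    colour-index : ∀ v → colour (Fin.finToFun (Fin.funToFin index)) v ≡ c v
    colour-index v = begin
      colour (Fin.finToFun (Fin.funToFin index)) v
        ≡⟨ cong (List.lookup (L v) ∘ Fin.cast (sym (len v))) (Fin.finToFun-funToFin index v) ⟩
      List.lookup (L v) (Fin.cast (sym (len v)) (index v))
        ≡⟨ cong (List.lookup (L v)) (trans (Fin.cast-trans (len v) (sym (len v)) _) (Fin.cast-is-id refl _)) ⟩
      List.lookup (L v) (Any.index (c∈L v))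
        ≡⟨ Any.lookup-index (c∈L v) ⟨
      c v ∎
      where open ≡-Reasoning

any-true⁻ : ∀ {A : Set} (p : A → Bool) xs → any p xs ≡ true → ∃[ x ] p x ≡ true
any-true⁻ p (x ∷ xs) e with p x in eq
... | true  = x , eq
... | false = any-true⁻ p xs e

theorem20 : ∀ {n : ℕ} (G : Graph n) →
    MaxDegreeAtMost G 3 → GirthAtLeast G 7 → MadLessThan G 18 7 →
    Choosable (sqAdj G) 6
theorem20 {n} G Δ≤3 girth mad L unique len =
  decidable-stable (listColoring? (sqAdj G) L len)
    (λ none → not-uncolorable full (⊂-wellFounded full) (none ∘ finish))
  where
  Coloring : Subset n → Set
  Coloring S = Neighbours.Coloring G S L

  -- Discharging does not produce a reducible tree; it only refutes that there is none. Hence the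
  -- conclusion is a double negation.
  not-uncolorable : ∀ S → Acc _⊂_ S → ¬ ¬ Coloring S
  not-uncolorable S (acc rec) uncolorable with nonempty? S
  -- The mad bound speaks of nonempty sets only; on the empty set the constant 0 is vacuously a
  -- colouring.
  ... | no empty     = uncolorable ((λ _ → 0)
                         , (λ v v∈S → contradiction (v , Vec.lookup⇒[]= v S v∈S) empty)
                         , (λ u v u∈S → contradiction (u , Vec.lookup⇒[]= u S u∈S) empty))
  ... | yes nonempty = ℕ.<⇒≱ (mad S nonempty)
                         (Counting.dense G S (Discharging.sends G Δ≤3 girth S irreducible)
                           (Discharging.balanced G Δ≤3 girth S irreducible))
    where
    open Reduction G Δ≤3 girth L unique len S

    irreducible : ∀ shape → Shape.Sound shape → ¬ Neighbours.Embedding G S shape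
    irreducible shape sound emb = not-uncolorable (Reduce.rest shape sound emb)
      (rec (Reduce.rest⊂S shape sound emb)) (uncolorable ∘ Reduce.extend shape sound emb)

  inFull : ∀ v → lookup full v ≡ true
  inFull v = Vec.[]=⇒lookup (∈⊤ {x = v})

  sqAdj⇒SQ : ∀ u v → sqAdj G u v ≡ true → Neighbours.SQ G full u v
  sqAdj⇒SQ u v e with u Fin.≟ v
  ... | no u≢v with adj G u v in uv
  ...   | true  = u≢v , inj₁ (Neighbours.∈N⁺ G full (inFull v) uv)
  ...   | false with w , e′ ← any-true⁻ (λ w → adj G u w ∧ adj G w v) (allFin n) e
                with uw , wv ← ∧-true⁻ (adj G u w) (adj G w v) e′ =
    u≢v , inj₂ (w , Neighbours.∈N⁺ G full (inFull w) uw , Neighbours.∈N⁺ G full (inFull v) wv)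

  finish : Coloring full → _
  finish (c , c∈L , proper) =
    c , (λ v → c∈L v (inFull v)) , (λ u v e → proper u v (inFull u) (inFull v) (sqAdj⇒SQ u v e))
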